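{- Let $G$ be a $3$-connected graph and let $e=u_1u_2$ be an edge of $G$. Then $G$ contains no pair of edge-disjoint cycles whose union contains $e$ if and only if $G$ has internally disjoint $(u_1,u_2)$-paths $\alpha=u_1,v_1,\dots,v_n,u_2$ and $\beta=u_1,w_1,\dots,w_n,u_2$, neither containing $e$, and there is a family $\mathcal P$ of pairwise disjoint pairs $\{i,i+1\}$ of consecutive elements of $\{1,\dots,n\}$ such that (a) $V(G)=V(\alpha)\cup V(\beta)$, and (b) $E(G)=\{v_iw_j,\ v_jw_i:\{i,j\}\in\mathcal P\}\cup\{v_kw_k: k \text{ belongs to no member of } \mathcal P\}\cup E(\alpha)\cup E(\beta)\cup\{e\}$.
   Context: Graphs are finite, without loops or parallel edges. "A pair of edge-disjoint cycles whose union contains $e$" means two cycles with no common edge, one of which contains the edge $e$. -}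

module Defs where

open import Data.Nat using (ℕ; zero; suc; _≤_; _<_)
open import Data.Fin using (Fin; toℕ)
open import Data.Bool using (Bool; true; false)
open import Data.List using (List; []; _∷_; _++_; [_]; length; tabulate)
open import Data.List.Membership.Propositional using (_∈_; _∉_)
open import Data.List.Relation.Unary.Unique.Propositional using (Unique)
open import Data.Product using (Σ; ∃; ∃-syntax; _×_; _,_)
open import Data.Sum using (_⊎_)
open import Relation.Binary.PropositionalEquality using (_≡_; _≢_)
open import Relation.Nullary using (¬_)

record Graph (N : ℕ) : Set where
  field
    E      : Fin N → Fin N → Bool
    sym    : ∀ x y → E x y ≡ E y x
    irrefl : ∀ x → E x x ≡ false

open Graph public

module _ {N : ℕ} where

  V = Fin N

  data Consec : List V → V → V → Set where
    here  : ∀ {a b xs} → Consec (a ∷ b ∷ xs) a b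
    there : ∀ {a b c xs} → Consec xs a b → Consec (c ∷ xs) a b

  OnList : List V → V → V → Set
  OnList xs x y = Consec xs x y ⊎ Consec xs y x

  AllAdj : Graph N → List V → Set
  AllAdj G xs = ∀ a b → Consec xs a b → E G a b ≡ true

  IsPath : Graph N → List V → Set
  IsPath G xs = Unique xs × AllAdj G xs

  close : List V → List V
  close []       = []
  close (x ∷ xs) = x ∷ (xs ++ [ x ])

  IsCycle : Graph N → List V → Set
  IsCycle G c = 3 ≤ length c × Unique c × AllAdj G (close c)

  CycEdge : List V → V → V → Set
  CycEdge c x y = OnList (close c) x y

  UEdge : V → V → V → V → Set
  UEdge a b x y = (x ≡ a × y ≡ b) ⊎ (x ≡ b × y ≡ a)

  -- reachability in G - S (walks all of whose later vertices avoid S)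
  data Reach (G : Graph N) (S : List V) : V → V → Set where
    rrefl : ∀ {x} → Reach G S x x
    rstep : ∀ {x y z} → E G x y ≡ true → y ∉ S → Reach G S y z → Reach G S x z

  ThreeConnected : Graph N → Set
  ThreeConnected G =
    3 < N × (∀ (S : List V) → length S ≤ 2 →
              ∀ x y → x ∉ S → y ∉ S → Reach G S x y)

  HasDisjointCyclePairThrough : Graph N → V → V → Set
  HasDisjointCyclePairThrough G u1 u2 =
    Σ (List V) λ c1 → Σ (List V) λ c2 →
      IsCycle G c1 × IsCycle G c2 ×
      (∀ x y → CycEdge c1 x y → ¬ CycEdge c2 x y) ×
      (CycEdge c1 u1 u2 ⊎ CycEdge c2 u1 u2)

  pathList : ∀ {n} → V → (Fin n → V) → V → List V
  pathList u1 p u2 = u1 ∷ (tabulate p ++ [ u2 ])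

  -- P i ≡ true  encodes that {i, i+1} is a member of the family 𝒫
  -- (indices 0-based: i here corresponds to i+1 in the paper)
  ValidFamily : (n : ℕ) → (Fin n → Bool) → Set
  ValidFamily n P =
    (∀ i → P i ≡ true → suc (toℕ i) < n) ×
    (∀ i j → toℕ j ≡ suc (toℕ i) → P i ≡ true → P j ≡ false)

  Uncovered : ∀ {n} → (Fin n → Bool) → Fin n → Set
  Uncovered P k = P k ≡ false × (∀ i → toℕ k ≡ suc (toℕ i) → P i ≡ false)

  Structure : Graph N → V → V → Set
  Structure G u1 u2 =
    Σ ℕ λ n → Σ (Fin n → V) λ v → Σ (Fin n → V) λ w → Σ (Fin n → Bool) λ P →
      let α = pathList u1 v u2
          β = pathList u1 w u2 in
      IsPath G α × IsPath G β ×
      (∀ i j → v i ≢ w j) ×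
      ¬ OnList α u1 u2 × ¬ OnList β u1 u2 ×
      ValidFamily n P ×
      (∀ x → x ∈ α ⊎ x ∈ β) ×
      (∀ x y → (E G x y ≡ true →
                  ( (∃[ i ] ∃[ j ] (P i ≡ true × toℕ j ≡ suc (toℕ i) ×
                        (UEdge (v i) (w j) x y ⊎ UEdge (v j) (w i) x y)))
                  ⊎ (∃[ k ] (Uncovered P k × UEdge (v k) (w k) x y))
                  ⊎ OnList α x y ⊎ OnList β x y ⊎ UEdge u1 u2 x y))
             × (( (∃[ i ] ∃[ j ] (P i ≡ true × toℕ j ≡ suc (toℕ i) ×
                        (UEdge (v i) (w j) x y ⊎ UEdge (v j) (w i) x y)))
                  ⊎ (∃[ k ] (Uncovered P k × UEdge (v k) (w k) x y))
                  ⊎ OnList α x y ⊎ OnList β x y ⊎ UEdge u1 u2 x y)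
                  → E G x y ≡ true))

{-# OPTIONS --safe #-}

-- (⇒) Whitney's induction gives two internally disjoint (u₁,u₂)-paths α, β in G − e. Deleting the
-- cycle α + e must leave a forest, and likewise for β + e; so no bridge of α ∪ β has two
-- attachments on the same path. As G is 3-connected, α ∪ β then spans G and, apart from e, the
-- remaining edges form a perfect matching v_i w_σ(i) between the interiors. Switching from α to β
-- along a chord shows that each chord is crossed at most once from either side, which forces the
-- permutation σ to be a product of disjoint adjacent transpositions.
--
-- (⇐) The cycle through e crosses every cut between consecutive levels in an edge other than e. Where
-- the cut consists of e and two path edges, only one edge is left for the second cycle, so it
-- does not cross. Where levels i and i + 1 are swapped, the second cycle would have to use all four
-- edges of the 4-cycle on these levels. Hence it lies in a single level, which contains no cycle.
module Submission where

open import Defs renaming (sym to E-sym; irrefl to E-irrefl)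
open import Data.Bool using (Bool; true; false; not)
import Data.Bool as Bool
open import Data.Bool.Properties using (¬-not; not-¬)
open import Data.Empty using (⊥; ⊥-elim)
open import Data.Fin using (Fin; zero; suc; toℕ; fromℕ<)
open import Data.Fin.Properties using (_≟_; toℕ-injective; toℕ<n; toℕ-fromℕ<; injective⇒≤)
open import Data.List using (List; []; _∷_; _++_; [_]; length; tabulate; lookup; allFin)
open import Data.List.Membership.Propositional using (_∈_; _∉_)
open import Data.List.Membership.Propositional.Properties using (∈-++⁺ˡ; ∈-++⁺ʳ; ∈-++⁻; ∈-lookup; ∈-tabulate⁺; ∈-tabulate⁻)
open import Data.List.Properties using (++-assoc; length-tabulate; tabulate-lookup)
open import Data.List.Relation.Unary.All using (All; []; _∷_)
open import Data.List.Relation.Unary.AllPairs using ([]; _∷_)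
open import Data.List.Relation.Unary.Any using (here; there; index)
open import Data.List.Relation.Unary.Any.Properties using (lookup-index)
open import Data.List.Relation.Unary.Unique.Propositional using (Unique)
open import Data.List.Relation.Unary.Unique.Propositional.Properties using (Unique[x∷xs]⇒x∉xs; allFin⁺)
open import Data.Nat using (ℕ; zero; suc; _≤_; _<_; z≤n; s≤s; _≤?_)
import Data.Nat as ℕ
open import Data.Nat.Properties using (≤-refl; ≤-trans; ≤-antisym; ≤-pred; <-irrefl; <⇒≱; ≰⇒>; n≤1+n; m≤n⇒m≤1+n; suc-injective; <-cmp; m≤n⇒m<n∨m≡n; 1+n≰n)
open import Data.Nat.Induction using (<-rec)
open import Data.Product using (∃-syntax; ∃₂; _×_; _,_; proj₁; proj₂)
open import Data.Sum using (_⊎_; inj₁; inj₂; [_,_]′; swap)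
import Data.Sum as Sum
open import Function using (_∘_)
open import Function.Bundles using (_⇔_; mk⇔)
open import Relation.Binary.Construct.Closure.ReflexiveTransitive using (Star; ε; _◅_; _◅◅_; reverse)
import Relation.Binary.Construct.Closure.ReflexiveTransitive as Star
open import Relation.Binary.PropositionalEquality using (_≡_; _≢_; refl; sym; trans; cong; subst; subst₂)
open import Relation.Binary.Definitions using (Tri; tri<; tri≈; tri>)
open import Relation.Nullary using (¬_; Dec; yes; no)
open import Relation.Nullary.Decidable using (_×-dec_; _⊎-dec_; isYes)

-- Lists: repetition, counting, and access by position.

module _ {A : Set} where

  ∈-snoc⁻ : ∀ xs {y z : A} → z ∈ xs ++ [ y ] → z ∈ xs ⊎ z ≡ y
  ∈-snoc⁻ xs z∈ with ∈-++⁻ xs z∈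
  ... | inj₁ p        = inj₁ p
  ... | inj₂ (here p) = inj₂ p

  Unique-++⇒disjoint : ∀ xs {ys} {z : A} → Unique (xs ++ ys) → z ∈ xs → z ∉ ys
  Unique-++⇒disjoint (x ∷ xs) u@(_ ∷ u′) (here refl) = λ z∈ → Unique[x∷xs]⇒x∉xs u (∈-++⁺ʳ xs z∈)
  Unique-++⇒disjoint (x ∷ xs) (_ ∷ u′) (there z∈) = Unique-++⇒disjoint xs u′ z∈

  Unique-++⇒ˡ : ∀ xs {ys : List A} → Unique (xs ++ ys) → Unique xs
  Unique-++⇒ˡ []       _       = []
  Unique-++⇒ˡ (x ∷ xs) (p ∷ u) = All-++⇒ˡ xs p ∷ Unique-++⇒ˡ xs u
    where
    All-++⇒ˡ : ∀ {P : A → Set} zs {ys} → All P (zs ++ ys) → All P zs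
    All-++⇒ˡ []       _        = []
    All-++⇒ˡ (z ∷ zs) (q ∷ qs) = q ∷ All-++⇒ˡ zs qs

  ∉⇒Unique-∷ : ∀ {x : A} {xs} → x ∉ xs → Unique xs → Unique (x ∷ xs)
  ∉⇒Unique-∷ {x} x∉ u = go _ x∉ ∷ u
    where
    go : ∀ ys → x ∉ ys → All (x ≢_) ys
    go []       _  = []
    go (y ∷ ys) ∉ = (∉ ∘ here) ∷ go ys (∉ ∘ there)

  lookup-injective : ∀ {xs : List A} → Unique xs → ∀ {i j} → lookup xs i ≡ lookup xs j → i ≡ j
  lookup-injective {x ∷ xs} u {zero} {zero} _ = refl
  lookup-injective {x ∷ xs} u {zero} {suc j} eq =
    ⊥-elim (Unique[x∷xs]⇒x∉xs u (subst (_∈ xs) (sym eq) (∈-lookup j)))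
  lookup-injective {x ∷ xs} u {suc i} {zero} eq =
    ⊥-elim (Unique[x∷xs]⇒x∉xs u (subst (_∈ xs) eq (∈-lookup i)))
  lookup-injective {x ∷ xs} (_ ∷ u) {suc i} {suc j} eq = cong suc (lookup-injective u eq)

  -- A witness chosen for each entry of `xs` gives an injection of index sets. The relational form
  -- serves two ends: with equality for `R` it is the pigeonhole principle, with adjacency it
  -- compares the two paths through their chords.
  length-≤ : ∀ {xs ys : List A} {R : A → A → Set} → Unique xs →
    (∀ x → x ∈ xs → ∃[ y ] (y ∈ ys × R x y)) →
    (∀ x x′ y → x ∈ xs → x′ ∈ xs → y ∈ ys → R x y → R x′ y → x ≡ x′) →
    length xs ≤ length ys
  length-≤ {xs} {ys} {R} u tot inj = injective⇒≤ {f = f} f-inj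
    where
    image : ∀ i → ∃[ y ] (y ∈ ys × R (lookup xs i) y)
    image i = tot (lookup xs i) (∈-lookup i)
    f : Fin (length xs) → Fin (length ys)
    f i = index (proj₁ (proj₂ (image i)))
    f-inj : ∀ {i j} → f i ≡ f j → i ≡ j
    f-inj {i} {j} eq = lookup-injective u
      (inj _ _ (proj₁ (image i)) (∈-lookup i) (∈-lookup j) (proj₁ (proj₂ (image i)))
        (proj₂ (proj₂ (image i)))
        (subst (R _) (sym same) (proj₂ (proj₂ (image j)))))
      where
      same : proj₁ (image i) ≡ proj₁ (image j)
      same = trans (lookup-index (proj₁ (proj₂ (image i))))
        (trans (cong (lookup ys) eq) (sym (lookup-index (proj₁ (proj₂ (image j))))))

  -- Positions in xs ++ [ d ]; every position past the end of xs reads d.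
  at : A → List A → ℕ → A
  at d []       _       = d
  at d (x ∷ xs) zero    = x
  at d (x ∷ xs) (suc k) = at d xs k

  at-length : ∀ d xs → at d xs (length xs) ≡ d
  at-length d []       = refl
  at-length d (x ∷ xs) = at-length d xs

  at-∈ : ∀ d xs {k} → k < length xs → at d xs k ∈ xs
  at-∈ d (x ∷ xs) {zero}  _         = here refl
  at-∈ d (x ∷ xs) {suc k} (s≤s k<) = there (at-∈ d xs k<)

  at-∈-snoc : ∀ d xs k → at d xs k ∈ xs ++ [ d ]
  at-∈-snoc d []       k       = here refl
  at-∈-snoc d (x ∷ xs) zero    = here refl
  at-∈-snoc d (x ∷ xs) (suc k) = there (at-∈-snoc d xs k)

  ∈-snoc⇒at : ∀ d xs {z} → z ∈ xs ++ [ d ] → ∃[ k ] (k ≤ length xs × at d xs k ≡ z)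
  ∈-snoc⇒at d []       (here refl) = 0 , z≤n , refl
  ∈-snoc⇒at d (x ∷ xs) (here refl) = 0 , z≤n , refl
  ∈-snoc⇒at d (x ∷ xs) (there z∈) with ∈-snoc⇒at d xs z∈
  ... | k , k≤ , eq = suc k , s≤s k≤ , eq

  ∈⇒at : ∀ d xs {z} → z ∈ xs → ∃[ k ] (k < length xs × at d xs k ≡ z)
  ∈⇒at d (x ∷ xs) (here refl) = 0 , s≤s z≤n , refl
  ∈⇒at d (x ∷ xs) (there z∈) with ∈⇒at d xs z∈
  ... | k , k≤ , eq = suc k , s≤s k≤ , eq

  -- The default `d` may occur in `xs`: a closed cycle is read with its own head as default, so the
  -- position `length xs` has to be excluded. `at-injective-snoc` can include it because there `d`
  -- is new.
  at-injective : ∀ d xs → Unique xs → ∀ {j k} → j < length xs → k < length xs →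
    at d xs j ≡ at d xs k → j ≡ k
  at-injective d (x ∷ xs) u {zero} {zero} _ _ _ = refl
  at-injective d (x ∷ xs) u {zero} {suc k} _ (s≤s k<) eq =
    ⊥-elim (Unique[x∷xs]⇒x∉xs u (subst (_∈ xs) (sym eq) (at-∈ d xs k<)))
  at-injective d (x ∷ xs) u {suc j} {zero} (s≤s j<) _ eq =
    ⊥-elim (Unique[x∷xs]⇒x∉xs u (subst (_∈ xs) eq (at-∈ d xs j<)))
  at-injective d (x ∷ xs) (_ ∷ u) {suc j} {suc k} (s≤s j<) (s≤s k<) eq =
    cong suc (at-injective d xs u j< k< eq)

  at-injective-snoc : ∀ d xs → Unique (xs ++ [ d ]) → ∀ {j k} → j ≤ length xs → k ≤ length xs →
    at d xs j ≡ at d xs k → j ≡ k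
  at-injective-snoc d [] u z≤n z≤n _ = refl
  at-injective-snoc d (x ∷ xs) u {zero} {zero} _ _ _ = refl
  at-injective-snoc d (x ∷ xs) u {zero} {suc k} _ _ eq =
    ⊥-elim (Unique[x∷xs]⇒x∉xs u (subst (_∈ xs ++ [ d ]) (sym eq) (at-∈-snoc d xs k)))
  at-injective-snoc d (x ∷ xs) u {suc j} {zero} _ _ eq =
    ⊥-elim (Unique[x∷xs]⇒x∉xs u (subst (_∈ xs ++ [ d ]) eq (at-∈-snoc d xs j)))
  at-injective-snoc d (x ∷ xs) (_ ∷ u) {suc j} {suc k} (s≤s j≤) (s≤s k≤) eq =
    cong suc (at-injective-snoc d xs u j≤ k≤ eq)

  at-tabulate : ∀ d {n} (p : Fin n → A) i → at d (tabulate p) (toℕ i) ≡ p i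
  at-tabulate d p zero    = refl
  at-tabulate d p (suc i) = at-tabulate d (p ∘ suc) i

  tabulate-split : ∀ {n} (p : Fin n → A) i → ∃₂ λ xs ys →
    tabulate p ≡ xs ++ p i ∷ ys ×
    (∀ j → toℕ j < toℕ i → p j ∈ xs) × (∀ j → toℕ i < toℕ j → p j ∈ ys)
  tabulate-split p zero = [] , tabulate (p ∘ suc) , refl , (λ _ ()) , after
    where
    after : ∀ j → 0 < toℕ j → p j ∈ tabulate (p ∘ suc)
    after (suc j) _ = ∈-tabulate⁺ j
  tabulate-split p (suc i) with tabulate-split (p ∘ suc) i
  ... | xs , ys , eq , lt , gt = p zero ∷ xs , ys , cong (p zero ∷_) eq , before , after
    where
    before : ∀ j → toℕ j < suc (toℕ i) → p j ∈ p zero ∷ xs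
    before zero    _        = here refl
    before (suc j) (s≤s j<) = there (lt j j<)
    after : ∀ j → suc (toℕ i) < toℕ j → p j ∈ ys
    after (suc j) (s≤s i<) = gt j i<

-- Permutations with few inversions.

module _ {n : ℕ} where

  -- In terms of chords from v_i to w_σ(i): at most one chord that starts later on the first path
  -- crosses the chord at `i`.
  FewInversions : (Fin n → Fin n) → Set
  FewInversions σ = ∀ {i j j′} → toℕ i < toℕ j → toℕ i < toℕ j′ → j ≢ j′ →
    toℕ (σ j) < toℕ (σ i) → ¬ (toℕ (σ j′) < toℕ (σ i))

  -- Meant for `τ` inverse to `σ`, where the equation makes `σ` an involution. An upper bound
  -- suffices, because the lower bound at `i` is the upper bound at `σ i`.
  AdjacentSwap : (σ τ : Fin n → Fin n) → Fin n → Set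
  AdjacentSwap σ τ i = σ i ≡ τ i × toℕ (σ i) ≤ suc (toℕ i)

  -- If `σ i` exceeded `i + 1`, the values `i` and `i + 1` would both lie below `σ i` and be taken
  -- at indices beyond `i`: two inversions. The index taking the value `i + 1` is not `i` itself,
  -- and by the bound in `ih` it is not smaller.
  image-≤-suc : ∀ {σ τ : Fin n → Fin n} → (∀ i → σ (τ i) ≡ i) → FewInversions σ →
    ∀ i → (∀ k → toℕ k < toℕ i → AdjacentSwap σ τ k) →
    toℕ i < toℕ (σ i) → toℕ i < toℕ (τ i) → toℕ (σ i) ≤ suc (toℕ i)
  image-≤-suc {σ} {τ} στ few i ih i<σi i<τi with toℕ (σ i) ≤? suc (toℕ i)
  ... | yes p = p
  ... | no  p = ⊥-elim (few i<τi i<τi′ τi≢τi′ (subst (λ k → toℕ k < toℕ (σ i)) (sym (στ i)) i<σi)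
                    (subst (λ k → toℕ k < toℕ (σ i)) (sym (στ i′)) i′<σi))
    where
    i+1<σi : suc (toℕ i) < toℕ (σ i)
    i+1<σi = ≰⇒> p
    i+1<n : suc (toℕ i) < n
    i+1<n = ≤-trans i+1<σi (≤-trans (n≤1+n _) (toℕ<n (σ i)))
    i′ : Fin n
    i′ = fromℕ< i+1<n
    i′≡ : toℕ i′ ≡ suc (toℕ i)
    i′≡ = toℕ-fromℕ< i+1<n
    i′<σi : toℕ i′ < toℕ (σ i)
    i′<σi = subst (_< toℕ (σ i)) (sym i′≡) i+1<σi
    τi≢τi′ : τ i ≢ τ i′
    τi≢τi′ q = <-irrefl (trans (cong toℕ (trans (sym (στ i)) (trans (cong σ q) (στ i′)))) i′≡) ≤-refl
    i<τi′ : toℕ i < toℕ (τ i′)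
    i<τi′ with <-cmp (toℕ i) (toℕ (τ i′))
    ... | tri< q _ _ = q
    ... | tri≈ _ q _ = ⊥-elim (<-irrefl (cong toℕ (trans (sym (στ i′)) (cong σ (sym (toℕ-injective q))))) i′<σi)
    ... | tri> _ _ q = ⊥-elim (1+n≰n (≤-trans (subst₂ _≤_ (trans (cong toℕ (στ i′)) i′≡) refl
                         (proj₂ (ih (τ i′) q))) q))

  abstract
    -- Strong induction on the index. If `σ i < i`, the hypothesis at `σ i` shows that `σ` maps
    -- `σ i` back to `i`. If `σ i > i`, then also `τ i > i`, and `image-≤-suc`, applied to both
    -- permutations, pins both values to `i + 1`.
    adjacentSwaps : ∀ {σ τ : Fin n → Fin n} → (∀ i → σ (τ i) ≡ i) → (∀ i → τ (σ i) ≡ i) →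
      FewInversions σ → FewInversions τ → ∀ i → AdjacentSwap σ τ i
    adjacentSwaps {σ} {τ} στ τσ fewσ fewτ i = <-rec _ step (toℕ i) i refl
      where
      step : ∀ m → (∀ {k} → k < m → ∀ j → toℕ j ≡ k → AdjacentSwap σ τ j) →
        ∀ j → toℕ j ≡ m → AdjacentSwap σ τ j
      step m rec i refl with <-cmp (toℕ (σ i)) (toℕ i)
      ... | tri< lt _ _ = σi≡τi , ≤-trans (n≤1+n _) (m≤n⇒m≤1+n lt)
        where
        σi≡τi : σ i ≡ τ i
        σi≡τi = trans (sym (τσ (σ i))) (cong τ (trans (proj₁ (rec lt (σ i) refl)) (τσ i)))
      ... | tri≈ _ eq _ = trans fix (trans (sym (τσ i)) (cong τ fix)) , subst (_≤ suc (toℕ i)) (sym eq) (n≤1+n _)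
        where
        fix : σ i ≡ i
        fix = toℕ-injective eq
      ... | tri> _ _ gt = toℕ-injective (trans (exact gt bound) (sym (exact i<τi bound′))) , bound
        where
        ih : ∀ k → toℕ k < toℕ i → AdjacentSwap σ τ k
        ih k k< = rec k< k refl
        i<τi : toℕ i < toℕ (τ i)
        i<τi with <-cmp (toℕ i) (toℕ (τ i))
        ... | tri< p _ _ = p
        ... | tri≈ _ p _ = ⊥-elim (<-irrefl (cong toℕ (trans (sym (στ i)) (cong σ (sym (toℕ-injective p))))) gt)
        ... | tri> _ _ p = ⊥-elim (<-irrefl refl (≤-trans gt (subst (_≤ toℕ i) (cong toℕ τi≡σi) (≤-trans (n≤1+n _) p))))
          where
          τi≡σi : τ i ≡ σ i
          τi≡σi = trans (sym (στ (τ i))) (cong σ (trans (sym (proj₁ (ih (τ i) p))) (στ i)))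
        bound : toℕ (σ i) ≤ suc (toℕ i)
        bound = image-≤-suc στ fewσ i ih gt i<τi
        bound′ : toℕ (τ i) ≤ suc (toℕ i)
        -- At smaller indices `σ` and `τ` agree, so the induction hypothesis may be read with the
        -- two exchanged.
        bound′ = image-≤-suc τσ fewτ i
          (λ k k< → let eq , le = ih k k< in sym eq , subst (λ j → toℕ j ≤ suc (toℕ k)) eq le) i<τi gt
        exact : ∀ {j k} → j < k → k ≤ suc j → k ≡ suc j
        exact p q = ≤-antisym q p

-- Consecutive pairs, walks, and closing walks to cycles.

module _ {N : ℕ} where

  open import Data.List.Membership.DecPropositional {A = Fin N} _≟_ using (_∈?_)

  fresh : ∀ (xs S : List (Fin N)) → Unique xs → length S < length xs → ∃[ t ] (t ∈ xs × t ∉ S)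
  fresh xs S u lt = search xs λ sub → <⇒≱ lt (length-≤ u (λ x x∈ → x , sub x∈ , refl) (λ _ _ _ _ _ _ p q → trans p (sym q)))
    where
    search : ∀ ys → ¬ (∀ {y} → y ∈ ys → y ∈ S) → ∃[ t ] (t ∈ ys × t ∉ S)
    search [] k = ⊥-elim (k λ ())
    search (y ∷ ys) k with y ∈? S
    ... | no y∉  = y , here refl , y∉
    ... | yes y∈ with search ys (λ sub → k λ { (here refl) → y∈ ; (there p) → sub p })
    ... | t , t∈ , t∉ = t , there t∈ , t∉

  Consec-∈ˡ : ∀ {xs} {a b : Fin N} → Consec xs a b → a ∈ xs
  Consec-∈ˡ here      = here refl
  Consec-∈ˡ (there c) = there (Consec-∈ˡ c)

  Consec-∈ʳ : ∀ {xs} {a b : Fin N} → Consec xs a b → b ∈ xs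
  Consec-∈ʳ here      = there (here refl)
  Consec-∈ʳ (there c) = there (Consec-∈ʳ c)

  Consec-++⁺ˡ : ∀ {xs ys} {a b : Fin N} → Consec xs a b → Consec (xs ++ ys) a b
  Consec-++⁺ˡ here      = here
  Consec-++⁺ˡ (there c) = there (Consec-++⁺ˡ c)

  Consec-++⁺ʳ : ∀ xs {ys} {a b : Fin N} → Consec ys a b → Consec (xs ++ ys) a b
  Consec-++⁺ʳ []       c = c
  Consec-++⁺ʳ (x ∷ xs) c = there (Consec-++⁺ʳ xs c)

  Consec? : ∀ xs (a b : Fin N) → Dec (Consec xs a b)
  Consec? [] a b = no λ ()
  Consec? (x ∷ []) a b = no λ { (there ()) }
  Consec? (x ∷ y ∷ xs) a b with x ≟ a | y ≟ b | Consec? (y ∷ xs) a b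
  ... | yes refl | yes refl | _     = yes here
  ... | _        | _        | yes c = yes (there c)
  ... | no x≢a   | _        | no ¬c = no λ { here → x≢a refl ; (there c) → ¬c c }
  ... | _        | no y≢b   | no ¬c = no λ { here → y≢b refl ; (there c) → ¬c c }

  OnList? : ∀ xs (a b : Fin N) → Dec (OnList xs a b)
  OnList? xs a b = Consec? xs a b ⊎-dec Consec? xs b a

  UEdge? : ∀ (a b x y : Fin N) → Dec (UEdge a b x y)
  UEdge? a b x y = (x ≟ a ×-dec y ≟ b) ⊎-dec (x ≟ b ×-dec y ≟ a)

  OnList-∈ˡ : ∀ {xs} {a b : Fin N} → OnList xs a b → a ∈ xs
  OnList-∈ˡ = [ Consec-∈ˡ , Consec-∈ʳ ]′

  OnList-∈ʳ : ∀ {xs} {a b : Fin N} → OnList xs a b → b ∈ xs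
  OnList-∈ʳ = [ Consec-∈ʳ , Consec-∈ˡ ]′

  UEdge-sym : ∀ {a b x y : Fin N} → UEdge a b x y → UEdge a b y x
  UEdge-sym (inj₁ (p , q)) = inj₂ (q , p)
  UEdge-sym (inj₂ (p , q)) = inj₁ (q , p)

  UEdge-flip : ∀ {a b x y : Fin N} → UEdge a b x y → UEdge b a x y
  UEdge-flip (inj₁ p) = inj₂ p
  UEdge-flip (inj₂ p) = inj₁ p

  Consec-snoc⇒at : ∀ d xs {a b : Fin N} → Consec (xs ++ [ d ]) a b →
    ∃[ k ] (k < length xs × at d xs k ≡ a × at d xs (suc k) ≡ b)
  Consec-snoc⇒at d [] (there ())
  Consec-snoc⇒at d (x ∷ []) here = 0 , s≤s z≤n , refl , refl
  Consec-snoc⇒at d (x ∷ []) (there (there ()))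
  Consec-snoc⇒at d (x ∷ y ∷ xs) here = 0 , s≤s z≤n , refl , refl
  Consec-snoc⇒at d (x ∷ y ∷ xs) (there c) with Consec-snoc⇒at d (y ∷ xs) c
  ... | k , k< , p , q = suc k , s≤s k< , p , q

  OnList-connected : ∀ xs {x y : Fin N} → x ∈ xs → y ∈ xs → Star (OnList xs) x y
  OnList-connected (a ∷ as) x∈ y∈ = reverse swap (fromHead a as x∈) ◅◅ fromHead a as y∈
    where
    fromHead : ∀ a as {y} → y ∈ a ∷ as → Star (OnList (a ∷ as)) a y
    fromHead a as       (here refl) = ε
    fromHead a (b ∷ as) (there y∈) = inj₁ here ◅ Star.map (Sum.map there there) (fromHead b as y∈)

  -- The index lists the vertices strictly between the two ends.
  data Walk (R : Fin N → Fin N → Set) : Fin N → List (Fin N) → Fin N → Set where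
    one  : ∀ {x y} → R x y → Walk R x [] y
    cons : ∀ {x y z zs} → R x z → Walk R z zs y → Walk R x (z ∷ zs) y

  module _ {R : Fin N → Fin N → Set} where

    Star⇒Walk : ∀ {x y} → Star R x y → x ≢ y → ∃[ zs ] Walk R x zs y
    Star⇒Walk ε x≢y = ⊥-elim (x≢y refl)
    Star⇒Walk {y = y} (_◅_ {j = z} r s) _ with z ≟ y
    ... | yes refl = [] , one r
    ... | no z≢y with Star⇒Walk s z≢y
    ... | zs , w = z ∷ zs , cons r w

    Walk-Consec : ∀ {x zs y} → Walk R x zs y → ∀ {a b} → Consec (x ∷ zs ++ [ y ]) a b → R a b
    Walk-Consec (one r)    here              = r
    Walk-Consec (one r)    (there (there ()))
    Walk-Consec (cons r w) here              = r
    Walk-Consec (cons r w) (there c)         = Walk-Consec w c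

    Walk-++ : ∀ {x zs y ws t} → Walk R x zs y → Walk R y ws t → Walk R x (zs ++ y ∷ ws) t
    Walk-++ (one r)    v = cons r v
    Walk-++ (cons r w) v = cons r (Walk-++ w v)

    Walk-snoc : ∀ {x zs y t} → Walk R x zs y → R y t → Walk R x (zs ++ [ y ]) t
    Walk-snoc w r = Walk-++ w (one r)

    Walk-reverse : (∀ {a b} → R a b → R b a) → ∀ {x zs y} → Walk R x zs y →
      ∃[ ws ] (Walk R y ws x × (∀ {a} → a ∈ ws → a ∈ zs))
    Walk-reverse sy (one r) = [] , one (sy r) , λ a∈ → a∈
    Walk-reverse sy (cons {z = z} r w) with Walk-reverse sy w
    ... | ws , w′ , sub = ws ++ [ z ] , Walk-snoc w′ (sy r) ,
      λ a∈ → [ there ∘ sub , here ]′ (∈-snoc⁻ ws a∈)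

    Walk-prefix : ∀ {x zs y t} → Walk R x zs y → t ∈ zs →
      ∃[ ws ] (Walk R x ws t × (∀ {a} → a ∈ ws → a ∈ zs))
    Walk-prefix (cons r w) (here refl) = [] , one r , λ ()
    Walk-prefix (cons {z = z} r w) (there t∈) with Walk-prefix w t∈
    ... | ws , w′ , sub = z ∷ ws , cons r w′ , λ { (here p) → here p ; (there a∈) → there (sub a∈) }

    SimpleWalk : Fin N → List (Fin N) → Fin N → Set
    SimpleWalk x zs y = Walk R x zs y × Unique (x ∷ zs ++ [ y ])

    Walk-suffix : ∀ {x zs y t} → SimpleWalk x zs y → t ∈ x ∷ zs →
      ∃[ ws ] (SimpleWalk t ws y × (∀ {a} → a ∈ ws → a ∈ zs))
    Walk-suffix sw (here refl) = _ , sw , λ a∈ → a∈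
    Walk-suffix (cons r w , _ ∷ u) (there t∈) with Walk-suffix (w , u) t∈
    ... | ws , sw , sub = ws , sw , there ∘ sub

    -- Loop erasure: the tail is made simple first, and if it meets `x` again, everything before
    -- that visit is dropped. No interior vertex is added, so disjointness of two walks survives.
    simplify : ∀ {x zs y} → Walk R x zs y → x ≢ y →
      ∃[ ws ] (SimpleWalk x ws y × (∀ {a} → a ∈ ws → a ∈ zs))
    simplify (one r) x≢y = [] , (one r , ∉⇒Unique-∷ (λ { (here p) → x≢y p }) ([] ∷ [])) , λ ()
    simplify {x} {y = y} (cons {z = z} r w) x≢y with z ≟ y
    ... | yes refl = [] , (one r , ∉⇒Unique-∷ (λ { (here p) → x≢y p }) ([] ∷ [])) , λ ()
    ... | no z≢y with simplify w z≢y
    ... | ws , sw , sub with x ∈? (z ∷ ws)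
    ... | yes x∈ with Walk-suffix sw x∈
    ... | ws′ , sw′ , sub′ = ws′ , sw′ , there ∘ sub ∘ sub′
    simplify {x} {y = y} (cons {z = z} r w) x≢y | no z≢y | ws , (w′ , u) , sub | no x∉ =
      z ∷ ws , (cons r w′ , ∉⇒Unique-∷ (λ x∈ → [ x∉ , x≢y ]′ (∈-snoc⁻ (z ∷ ws) x∈)) u) ,
      λ { (here p) → here p ; (there a∈) → there (sub a∈) }

  Consec-close⁻ : ∀ xs {y z a b : Fin N} → Consec ((xs ++ [ y ]) ++ [ z ]) a b →
    Consec (xs ++ [ y ]) a b ⊎ (a ≡ y × b ≡ z)
  Consec-close⁻ [] here = inj₂ (refl , refl)
  Consec-close⁻ [] (there (there ()))
  Consec-close⁻ (x ∷ []) here = inj₁ here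
  Consec-close⁻ (x ∷ x′ ∷ xs) here = inj₁ here
  Consec-close⁻ (x ∷ xs) (there c) = Sum.map₁ there (Consec-close⁻ xs c)

  Consec-close⁺ : ∀ xs {y z : Fin N} → Consec ((xs ++ [ y ]) ++ [ z ]) y z
  Consec-close⁺ []       = here
  Consec-close⁺ (x ∷ xs) = there (Consec-close⁺ xs)

  -- A simple path from `x` to `y` that avoids the edge between them has an interior vertex, so this
  -- edge closes it to a cycle of length at least three.
  cycle : ∀ {R : Fin N → Fin N → Set} {x y} → (∀ {a b} → R a b → R b a) → x ≢ y → R x y →
    Star (λ a b → R a b × ¬ UEdge x y a b) x y →
    ∃[ c ] (3 ≤ length c × Unique c × (∀ {a b} → CycEdge c a b → R a b) × CycEdge c x y)
  cycle {R} {x} {y} sy x≢y r s with Star⇒Walk s x≢y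
  ... | _ , w₀ with simplify w₀ x≢y
  ... | [] , (one (_ , ne) , _) , _ = ⊥-elim (ne (inj₁ (refl , refl)))
  ... | zs@(z ∷ zs′) , (w , u) , _ =
    x ∷ zs ++ [ y ] , long zs′ , u , [ edge , sy ∘ edge ]′ , inj₂ (there (Consec-close⁺ zs))
    where
    long : ∀ ws → 3 ≤ suc (suc (length (ws ++ [ y ])))
    long []       = ≤-refl
    long (_ ∷ ws) = m≤n⇒m≤1+n (long ws)
    edge : ∀ {a b} → Consec (x ∷ (zs ++ [ y ]) ++ [ x ]) a b → R a b
    edge c with Consec-close⁻ (x ∷ zs) c
    ... | inj₁ c′            = proj₁ (Walk-Consec w c′)
    ... | inj₂ (refl , refl) = sy r

  E-sym′ : (G : Graph N) → ∀ {a b} → E G a b ≡ true → E G b a ≡ true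
  E-sym′ G {a} {b} p = trans (E-sym G b a) p

  E⇒≢ : (G : Graph N) → ∀ {a b} → E G a b ≡ true → a ≢ b
  E⇒≢ G {a} p refl with trans (sym p) (E-irrefl G a)
  ... | ()

  -- Every contradiction with the absence of a cycle pair goes through this form: two disjoint
  -- classes of edges, each with an edge whose ends stay connected in the class without it.
  cyclePair : (G : Graph N) {R₁ R₂ : Fin N → Fin N → Set} {u₁ u₂ x y : Fin N} →
    (∀ {a b} → R₁ a b → R₁ b a) → (∀ {a b} → R₂ a b → R₂ b a) →
    (∀ {a b} → R₁ a b → E G a b ≡ true) → (∀ {a b} → R₂ a b → E G a b ≡ true) →
    (∀ {a b} → R₁ a b → ¬ R₂ a b) →
    R₁ u₁ u₂ → Star (λ a b → R₁ a b × ¬ UEdge u₁ u₂ a b) u₁ u₂ →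
    R₂ x y → Star (λ a b → R₂ a b × ¬ UEdge x y a b) x y →
    HasDisjointCyclePairThrough G u₁ u₂
  cyclePair G sy₁ sy₂ sub₁ sub₂ dis r₁ s₁ r₂ s₂
    with cycle sy₁ (E⇒≢ G (sub₁ r₁)) r₁ s₁ | cycle sy₂ (E⇒≢ G (sub₂ r₂)) r₂ s₂
  ... | c₁ , l₁ , q₁ , e₁ , on | c₂ , l₂ , q₂ , e₂ , _ =
    c₁ , c₂ , (l₁ , q₁ , λ a b c → sub₁ (e₁ (inj₁ c))) , (l₂ , q₂ , λ a b c → sub₂ (e₂ (inj₁ c))) ,
    (λ a b p q → dis (e₁ p) (e₂ q)) , inj₁ on

  -- Whitney's induction: two internally disjoint paths in G - e.

  module Detour (G : Graph N) (3conn : ThreeConnected G) (u₁ u₂ : Fin N) (u₁u₂ : E G u₁ u₂ ≡ true) where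

    H : Fin N → Fin N → Set
    H a b = E G a b ≡ true × ¬ UEdge u₁ u₂ a b

    H-sym : ∀ {a b} → H a b → H b a
    H-sym (p , ne) = E-sym′ G p , ne ∘ UEdge-sym

    u₁≢u₂ : u₁ ≢ u₂
    u₁≢u₂ = E⇒≢ G u₁u₂

    fresh³ : ∀ (a b c : Fin N) → ∃[ z ] (z ≢ a × z ≢ b × z ≢ c)
    fresh³ a b c with fresh (allFin N) (a ∷ b ∷ c ∷ []) (allFin⁺ N)
                           (subst (3 <_) (sym (length-tabulate _)) (proj₁ 3conn))
    ... | z , _ , z∉ = z , z∉ ∘ here , (λ p → z∉ (there (here p))) , λ p → z∉ (there (there (here p)))

    _∖_ : (Fin N → Fin N → Set) → Fin N → Fin N → Fin N → Set
    (R ∖ x) a b = R a b × a ≢ x × b ≢ x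

    ∖-sym : ∀ {x a b} → (H ∖ x) a b → (H ∖ x) b a
    ∖-sym (h , p , q) = H-sym h , q , p

    -- The first hypothesis holds when `s` is an end of e: deleting the vertex `s` then deletes e as
    -- well, so a walk that avoids `x` and `s` in `G` is a walk in `H` without `x`.
    Reach⇒Star : ∀ {x s a b} → (∀ {c d} → c ≢ s → d ≢ s → ¬ UEdge u₁ u₂ c d) →
      a ≢ x → a ≢ s → Reach G (x ∷ s ∷ []) a b → Star (H ∖ x) a b
    Reach⇒Star noE a≢x a≢s rrefl = ε
    Reach⇒Star noE a≢x a≢s (rstep e y∉ r) =
      ((e , noE a≢s λ p → y∉ (there (here p))) , a≢x , y∉ ∘ here) ◅
      Reach⇒Star noE (y∉ ∘ here) (λ p → y∉ (there (here p))) r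

    -- The route goes through a fourth vertex `z`. Its first half avoids `u₂` and its second half
    -- avoids `u₁`, so neither half can use e.
    detour : ∀ {x} → u₁ ≢ x → u₂ ≢ x → Star (H ∖ x) u₁ u₂
    detour {x} u₁≢x u₂≢x with fresh³ x u₁ u₂
    ... | z , z≢x , z≢u₁ , z≢u₂ =
      Reach⇒Star (λ { p q (inj₁ (_ , r)) → q r ; p q (inj₂ (r , _)) → p r }) u₁≢x u₁≢u₂
        (proj₂ 3conn (x ∷ u₂ ∷ []) ≤-refl u₁ z
          (λ { (here p) → u₁≢x p ; (there (here p)) → u₁≢u₂ p })
          (λ { (here p) → z≢x p ; (there (here p)) → z≢u₂ p }))
      ◅◅
      Reach⇒Star (λ { p q (inj₁ (r , _)) → p r ; p q (inj₂ (_ , r)) → q r }) z≢x z≢u₁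
        (proj₂ 3conn (x ∷ u₁ ∷ []) ≤-refl z u₂
          (λ { (here p) → z≢x p ; (there (here p)) → z≢u₁ p })
          (λ { (here p) → u₂≢x p ; (there (here p)) → u₁≢u₂ (sym p) }))

    -- A walk in `G` without `x` is repaired by replacing each passage along e with the `detour`.
    H-2-connected : ∀ {x a b} → a ≢ x → b ≢ x → Star (H ∖ x) a b
    H-2-connected {x} {a} {b} a≢x b≢x =
      go a≢x (proj₂ 3conn (x ∷ []) (s≤s z≤n) a b (λ { (here p) → a≢x p }) (λ { (here p) → b≢x p }))
      where
      go : ∀ {c} → c ≢ x → Reach G (x ∷ []) c b → Star (H ∖ x) c b
      go c≢x rrefl = ε
      go {c} c≢x (rstep {y = d} e d∉ r) with UEdge? u₁ u₂ c d
      ... | no ne = ((e , ne) , c≢x , d∉ ∘ here) ◅ go (d∉ ∘ here) r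
      ... | yes (inj₁ (refl , refl)) = detour c≢x (d∉ ∘ here) ◅◅ go (d∉ ∘ here) r
      ... | yes (inj₂ (refl , refl)) = reverse ∖-sym (detour (d∉ ∘ here) c≢x) ◅◅ go (d∉ ∘ here) r

    -- Both lists may be empty, the two paths then being the same edge; this lets the induction
    -- start at a neighbour of `u₁`. At `u₂` it cannot happen, as e is not in `H`.
    record TwoPaths (y : Fin N) : Set where
      constructor twoPaths
      field
        {A B} : List (Fin N)
        walkA : Walk H u₁ A y
        walkB : Walk H u₁ B y
        uA    : Unique (u₁ ∷ A ++ [ y ])
        uB    : Unique (u₁ ∷ B ++ [ y ])
        A∩B=∅ : ∀ {a} → a ∈ A → a ∉ B

    swapPaths : ∀ {y} → TwoPaths y → TwoPaths y
    swapPaths (twoPaths wA wB uA uB d) = twoPaths wB wA uB uA λ p q → d q p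

    mkTwoPaths : ∀ {y A B} → u₁ ≢ y → Walk H u₁ A y → Walk H u₁ B y →
      (∀ {a} → a ∈ A → a ∉ B) → TwoPaths y
    mkTwoPaths u₁≢y wA wB d with simplify wA u₁≢y | simplify wB u₁≢y
    ... | _ , (wA′ , uA) , subA | _ , (wB′ , uB) , subB =
      twoPaths wA′ wB′ uA uB λ p q → d (subA p) (subB q)

    end∉ : ∀ {x y : Fin N} {zs} → Unique (x ∷ zs ++ [ y ]) → y ∉ zs
    end∉ {zs = zs} (_ ∷ u) y∈ = Unique-++⇒disjoint zs u y∈ (here refl)

    -- Cuts an ear off where it first meets the paths already built, so that its interior stays
    -- clear of them.
    firstHit : ∀ {T : Fin N → Set} → (∀ a → Dec (T a)) → ∀ {x a t} → ¬ T a → T t → Star (H ∖ x) a t →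
      ∃₂ λ zs z → Walk H a zs z × T z × (∀ {b} → b ∈ zs → ¬ T b × b ≢ x)
    firstHit T? ¬Ta Tt ε = ⊥-elim (¬Ta Tt)
    firstHit T? ¬Ta Tt (_◅_ {j = c} (h , _ , c≢x) s) with T? c
    ... | yes Tc = [] , c , one h , Tc , λ ()
    ... | no ¬Tc with firstHit T? ¬Tc Tt s
    ... | zs , z , w , Tz , out =
      c ∷ zs , z , cons h w , Tz , λ { (here refl) → ¬Tc , c≢x ; (there b∈) → out b∈ }

    extend : ∀ {y y′} (P : TwoPaths y) → u₁ ≢ y′ → H y y′ → ∀ {C} → Walk H u₁ C y′ →
      (∀ {a} → a ∈ C → a ∉ TwoPaths.B P × a ≢ y) → TwoPaths y′
    extend (twoPaths {B = B} wA wB uA uB d) u₁≢y′ h wC out =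
      mkTwoPaths u₁≢y′ wC (Walk-snoc wB h)
        λ a∈C a∈ → [ proj₁ (out a∈C) , proj₂ (out a∈C) ]′ (∈-snoc⁻ B a∈)

    -- Whitney's step: an ear from y′ back to the two paths, avoiding y, reroutes the path it meets.
    extendA : ∀ {y y′ z zs} (P : TwoPaths y) → u₁ ≢ y′ → H y y′ → z ∈ TwoPaths.A P → Walk H y′ zs z →
      (∀ {b} → b ∈ zs → b ∉ TwoPaths.B P × b ≢ y) → TwoPaths y′
    extendA {z = z} P u₁≢y′ h z∈ w out
      with Walk-prefix (TwoPaths.walkA P) z∈ | Walk-reverse H-sym w
    ... | ws , w₁ , sub₁ | zs′ , w₂ , sub₂ = extend P u₁≢y′ h (Walk-++ w₁ w₂) avoid
      where
      avoidA : ∀ {a} → a ∈ TwoPaths.A P → a ∉ TwoPaths.B P × a ≢ _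
      avoidA a∈ = TwoPaths.A∩B=∅ P a∈ , λ { refl → end∉ (TwoPaths.uA P) a∈ }
      avoid : ∀ {a} → a ∈ ws ++ z ∷ zs′ → a ∉ TwoPaths.B P × a ≢ _
      avoid a∈ with ∈-++⁻ ws a∈
      ... | inj₁ p           = avoidA (sub₁ p)
      ... | inj₂ (here refl) = avoidA z∈
      ... | inj₂ (there p)   = out (sub₂ p)

    -- If `y′` lies on one path, that path is stopped at `y′` and the other is prolonged through
    -- `y`. Otherwise an ear leads from `y′` back to `u₁` or to one of the paths without meeting
    -- `y`: at `u₁` it is a new path by itself, and elsewhere it reroutes the path that it meets.
    step : ∀ {y y′} → u₁ ≢ y → u₁ ≢ y′ → H y y′ → TwoPaths y → TwoPaths y′
    step {y} {y′} u₁≢y u₁≢y′ h P@(twoPaths {A} {B} wA wB uA uB d)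
      with y′ ∈? A | y′ ∈? B
    ... | yes y′∈ | _ with Walk-prefix wA y′∈
    ... | ws , w , sub = extend P u₁≢y′ h w λ a∈ → d (sub a∈) , λ { refl → end∉ uA (sub a∈) }
    step {y} {y′} u₁≢y u₁≢y′ h P@(twoPaths {A} {B} wA wB uA uB d) | no _ | yes y′∈ with Walk-prefix wB y′∈
    ... | ws , w , sub =
      extend (swapPaths P) u₁≢y′ h w λ a∈ → (λ a∈A → d a∈A (sub a∈)) , λ { refl → end∉ uB (sub a∈) }
    step {y} {y′} u₁≢y u₁≢y′ h P@(twoPaths {A} {B} wA wB uA uB d) | no y′∉A | no y′∉B
      with firstHit {T = _∈ u₁ ∷ A ++ B} (λ a → a ∈? (u₁ ∷ A ++ B))
             (λ { (here p) → u₁≢y′ (sym p) ; (there p) → [ y′∉A , y′∉B ]′ (∈-++⁻ A p) }) (here refl)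
             (H-2-connected (λ p → E⇒≢ G (proj₁ h) (sym p)) u₁≢y)
    ... | zs , z , w , here refl , out with Walk-reverse H-sym w
    ... | zs′ , w′ , sub =
      extend P u₁≢y′ h w′ λ a∈ → (λ a∈B → proj₁ (out (sub a∈)) (there (∈-++⁺ʳ A a∈B))) , proj₂ (out (sub a∈))
    step {y} {y′} u₁≢y u₁≢y′ h P@(twoPaths {A} {B} wA wB uA uB d) | no _ | no _
        | zs , z , w , there z∈ , out with ∈-++⁻ A z∈
    ... | inj₁ z∈A = extendA P u₁≢y′ h z∈A w
      λ b∈ → (λ b∈B → proj₁ (out b∈) (there (∈-++⁺ʳ A b∈B))) , proj₂ (out b∈)
    ... | inj₂ z∈B = extendA (swapPaths P) u₁≢y′ h z∈B w
      λ b∈ → (λ b∈A → proj₁ (out b∈) (there (∈-++⁺ˡ b∈A))) , proj₂ (out b∈)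

    -- Induction along a walk in `H`. `TwoPaths u₁` is empty, since its paths would repeat `u₁`; so
    -- whenever the walk returns to `u₁`, the construction starts afresh from the next vertex.
    advance : ∀ {y t} → u₁ ≢ t → u₁ ≢ y → Star H y t → TwoPaths y → TwoPaths t
    start   : ∀ {t} → u₁ ≢ t → Star H u₁ t → TwoPaths t
    advance u₁≢t u₁≢y ε P = P
    advance u₁≢t u₁≢y (_◅_ {j = y′} h s) P with u₁ ≟ y′
    ... | yes refl = start u₁≢t s
    ... | no u₁≢y′ = advance u₁≢t u₁≢y′ s (step u₁≢y u₁≢y′ h P)
    start u₁≢t ε = ⊥-elim (u₁≢t refl)
    start u₁≢t (h ◅ s) = advance u₁≢t u₁≢y s (mkTwoPaths u₁≢y (one h) (one h) λ ())
      where
      u₁≢y : u₁ ≢ _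
      u₁≢y = E⇒≢ G (proj₁ h)

    menger : TwoPaths u₂
    menger with fresh³ u₁ u₂ u₂
    ... | z , z≢u₁ , z≢u₂ , _ =
      start u₁≢u₂ (Star.map proj₁ (detour (λ p → z≢u₁ (sym p)) (λ p → z≢u₂ (sym p))))

    -- Pairs of paths and the edges off the cycle through e.

    path : List (Fin N) → List (Fin N)
    path A = u₁ ∷ A ++ [ u₂ ]

    -- The conditions are symmetric in the two paths, so a fact shown for one path is used for the
    -- other through `swapFrame`.
    record Frame (A B : List (Fin N)) : Set where
      field
        uA    : Unique (path A)
        uB    : Unique (path B)
        adjA  : ∀ {a b} → Consec (path A) a b → E G a b ≡ true
        adjB  : ∀ {a b} → Consec (path B) a b → E G a b ≡ true
        A∩B=∅ : ∀ {a} → a ∈ A → a ∉ B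
        neA   : ¬ OnList (path A) u₁ u₂
        neB   : ¬ OnList (path B) u₁ u₂

    swapFrame : ∀ {A B} → Frame A B → Frame B A
    swapFrame F = record
      { uA = uB ; uB = uA ; adjA = adjB ; adjB = adjA ; A∩B=∅ = λ p q → A∩B=∅ q p ; neA = neB ; neB = neA }
      where open Frame F

    abstract
      frame : ∃₂ Frame
      frame = _ , _ , record
        { uA = uA ; uB = uB
        ; adjA = proj₁ ∘ Walk-Consec walkA ; adjB = proj₁ ∘ Walk-Consec walkB
        ; A∩B=∅ = A∩B=∅
        ; neA = avoids walkA ; neB = avoids walkB }
        where
        open TwoPaths menger
        avoids : ∀ {C} → Walk H u₁ C u₂ → ¬ OnList (path C) u₁ u₂
        avoids w (inj₁ c) = proj₂ (Walk-Consec w c) (inj₁ (refl , refl))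
        avoids w (inj₂ c) = proj₂ (Walk-Consec w c) (inj₂ (refl , refl))

    ∈-path⁻ : ∀ {A z} → z ∈ path A → z ∈ A ⊎ (z ≡ u₁ ⊎ z ≡ u₂)
    ∈-path⁻         (here p)  = inj₂ (inj₁ p)
    ∈-path⁻ {A = A} (there p) = Sum.map₂ inj₂ (∈-snoc⁻ A p)

    ∈⇒∈-path : ∀ {A z} → z ∈ A → z ∈ path A
    ∈⇒∈-path p = there (∈-++⁺ˡ p)

    u₁∈path : ∀ {A} → u₁ ∈ path A
    u₁∈path = here refl

    u₂∈path : ∀ {A} → u₂ ∈ path A
    u₂∈path {A} = there (∈-++⁺ʳ A (here refl))

    end∈path : ∀ {A z} → z ≡ u₁ ⊎ z ≡ u₂ → z ∈ path A
    end∈path     (inj₁ refl) = u₁∈path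
    end∈path {A} (inj₂ refl) = u₂∈path {A}

    OnList-UEdge : ∀ {xs : List (Fin N)} {a b x y} → UEdge a b x y → OnList xs x y → OnList xs a b
    OnList-UEdge (inj₁ (refl , refl)) o = o
    OnList-UEdge (inj₂ (refl , refl)) o = swap o

    ends⇒UEdge : ∀ {a b} → E G a b ≡ true → a ≡ u₁ ⊎ a ≡ u₂ → b ≡ u₁ ⊎ b ≡ u₂ → UEdge u₁ u₂ a b
    ends⇒UEdge e (inj₁ refl) (inj₁ refl) = ⊥-elim (E⇒≢ G e refl)
    ends⇒UEdge e (inj₁ p)    (inj₂ q)    = inj₁ (p , q)
    ends⇒UEdge e (inj₂ p)    (inj₁ q)    = inj₂ (p , q)
    ends⇒UEdge e (inj₂ refl) (inj₂ refl) = ⊥-elim (E⇒≢ G e refl)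

    module _ {A B : List (Fin N)} (F : Frame A B) where
      open Frame F

      interior : ∀ {z} → z ∈ A → ¬ (z ≡ u₁ ⊎ z ≡ u₂)
      interior z∈ (inj₁ refl) = Unique[x∷xs]⇒x∉xs uA (∈-++⁺ˡ z∈)
      interior z∈ (inj₂ refl) = end∉ uA z∈

      common : ∀ {z} → z ∈ path A → z ∈ path B → z ≡ u₁ ⊎ z ≡ u₂
      common zA zB with ∈-path⁻ zA | ∈-path⁻ zB
      ... | inj₁ p | inj₁ q = ⊥-elim (A∩B=∅ p q)
      ... | inj₂ p | _      = p
      ... | _      | inj₂ q = q

      A∉B-path : ∀ {z} → z ∈ A → z ∉ path B
      A∉B-path zA zB = interior zA (common (∈⇒∈-path zA) zB)

      OnA-E : ∀ {a b} → OnList (path A) a b → E G a b ≡ true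
      OnA-E = [ adjA , E-sym′ G ∘ adjA ]′

      OnA⇒¬e : ∀ {a b} → OnList (path A) a b → ¬ UEdge u₁ u₂ a b
      OnA⇒¬e o u = neA (OnList-UEdge u o)

      -- The complement of the cycle formed by the first path and e; without a cycle pair these
      -- edges form a forest.
      Off : Fin N → Fin N → Set
      Off a b = E G a b ≡ true × ¬ (OnList (path A) a b ⊎ UEdge u₁ u₂ a b)

      OffMinus : Fin N → Fin N → Fin N → Fin N → Set
      OffMinus x y a b = Off a b × ¬ UEdge x y a b

    -- An edge on both paths would have its ends among `u₁` and `u₂`, so it would be e, which
    -- neither path contains.
    OnB⇒Off : ∀ {A B} (F : Frame A B) → ∀ {a b} → OnList (path B) a b → Off F a b
    OnB⇒Off F {a} {b} o = OnA-E F′ o , [ notA , OnA⇒¬e F′ o ]′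
      where
      F′ = swapFrame F
      notA : ¬ OnList (path _) a b
      notA o′ = OnA⇒¬e F′ o (ends⇒UEdge (OnA-E F′ o) (common F (OnList-∈ˡ o′) (OnList-∈ˡ o))
        (common F (OnList-∈ʳ o′) (OnList-∈ʳ o)))

    alongB : ∀ {A B} (F : Frame A B) → ∀ {x y a b} → a ∈ path B → b ∈ path B →
      (∀ {c d} → OnList (path B) c d → ¬ UEdge x y c d) → Star (OffMinus F x y) a b
    alongB F a∈ b∈ avoid = Star.map (λ o → OnB⇒Off F o , avoid o) (OnList-connected (path _) a∈ b∈)

    avoid∉ : ∀ {xs : List (Fin N)} {x y c d} → x ∉ xs → OnList xs c d → ¬ UEdge x y c d
    avoid∉ x∉ o (inj₁ (refl , _)) = x∉ (OnList-∈ˡ o)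
    avoid∉ x∉ o (inj₂ (_ , refl)) = x∉ (OnList-∈ʳ o)

    -- Consequences of the absence of a cycle pair.

    module _ (noPair : ¬ HasDisjointCyclePairThrough G u₁ u₂) where

      -- The first path together with e is one cycle through e, and an edge of `Off` whose ends stay
      -- connected in `Off` would supply a second.
      noCycleOff : ∀ {A B} (F : Frame A B) → ∀ {x y} → Off F x y → ¬ Star (OffMinus F x y) x y
      noCycleOff {A} F off s = noPair (cyclePair G {R₁ = On} {R₂ = Off F}
        (Sum.map swap UEdge-sym) (λ { (e , n) → E-sym′ G e , n ∘ Sum.map swap UEdge-sym })
        [ OnA-E F , eE ]′ proj₁ (λ on off′ → proj₂ off′ on)
        (inj₂ (inj₁ (refl , refl)))
        (Star.map (λ o → inj₁ o , OnA⇒¬e F o) (OnList-connected (path A) u₁∈path (u₂∈path {A})))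
        off s)
        where
        On : Fin N → Fin N → Set
        On a b = OnList (path A) a b ⊎ UEdge u₁ u₂ a b
        eE : ∀ {a b} → UEdge u₁ u₂ a b → E G a b ≡ true
        eE (inj₁ (refl , refl)) = u₁u₂
        eE (inj₂ (refl , refl)) = E-sym′ G u₁u₂

      -- Any further edge would be closed to a cycle by the second path itself, away from the first
      -- path and e.
      noChord : ∀ {A B} (F : Frame A B) → ∀ {x y} → x ∈ path B → y ∈ path B → E G x y ≡ true →
        OnList (path B) x y ⊎ UEdge u₁ u₂ x y
      noChord {A} {B} F {x} {y} x∈ y∈ e with OnList? (path B) x y | UEdge? u₁ u₂ x y
      ... | yes o | _     = inj₁ o
      ... | no _  | yes u = inj₂ u
      ... | no ¬o | no ¬u = ⊥-elim (noCycleOff F (e , [ notA , ¬u ]′)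
              (alongB F x∈ y∈ λ { o (inj₁ (refl , refl)) → ¬o o ; o (inj₂ (refl , refl)) → ¬o (swap o) }))
        where
        notA : ¬ OnList (path A) x y
        notA o = ¬u (ends⇒UEdge e (common F (OnList-∈ˡ o) x∈) (common F (OnList-∈ʳ o) y∈))

      chordOff : ∀ {A B} (F : Frame A B) → ∀ {x y} → y ∈ B → E G x y ≡ true → Off F x y
      chordOff F y∈ e = e ,
        [ (λ o → A∉B-path (swapFrame F) y∈ (OnList-∈ʳ o))
        , (λ { (inj₁ (_ , p)) → interior (swapFrame F) y∈ (inj₂ p)
             ; (inj₂ (_ , p)) → interior (swapFrame F) y∈ (inj₁ p) }) ]′

      -- Two chords from `x` and the stretch of the second path between their ends would form a
      -- cycle in `Off`.
      chord-unique : ∀ {A B} (F : Frame A B) → ∀ {x y y′} → x ∈ A → y ∈ B → y′ ∈ B →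
        E G x y ≡ true → E G x y′ ≡ true → y ≡ y′
      chord-unique F {x} {y} {y′} x∈ y∈ y′∈ e e′ with y ≟ y′
      ... | yes p = p
      ... | no y≢y′ = ⊥-elim (noCycleOff F (chordOff F y∈ e)
        ((chordOff F y′∈ e′ , (λ { (inj₁ (_ , p)) → y≢y′ (sym p) ; (inj₂ (_ , p)) → E⇒≢ G e′ (sym p) }))
          ◅ alongB F (∈⇒∈-path y′∈) (∈⇒∈-path y∈) (avoid∉ (A∉B-path F x∈))))

      -- An ear through vertices off both paths uses neither e nor an edge of the first path. With
      -- two different ends on the second path it would be closed along that path to a cycle in
      -- `Off`.
      noOutsideEar : ∀ {A B} (F : Frame A B) → ∀ {s s′ q q′} → s ∈ path B → s′ ∈ path B → s ≢ s′ →
        q ∉ path A → q ∉ path B → q′ ∉ path A →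
        Star (λ a b → E G a b ≡ true × (a ∉ path A × a ∉ path B) × (b ∉ path A × b ∉ path B)) q q′ →
        E G q s ≡ true → ¬ (E G q′ s′ ≡ true)
      noOutsideEar {A} {B} F {s} {s′} {q} {q′} s∈ s′∈ s≢s′ q∉A q∉B q′∉A st e e′ =
        noCycleOff F (off q∉A e)
          (Star.map (λ { (e , (a∉ , a∉B) , (b∉ , b∉B)) → off a∉ e ,
              λ { (inj₁ (_ , refl)) → b∉B s∈ ; (inj₂ (refl , _)) → a∉B s∈ } }) st
           ◅◅ (off q′∉A e′ , (λ { (inj₁ (_ , refl)) → s≢s′ refl ; (inj₂ (_ , refl)) → q∉B s′∈ }))
           ◅ alongB F s′∈ s∈ (avoid∉ q∉B))
        where
        off : ∀ {a b} → a ∉ path A → E G a b ≡ true → Off F a b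
        off a∉ e = e , [ a∉ ∘ OnList-∈ˡ
                       , (λ { (inj₁ (refl , _)) → a∉ u₁∈path ; (inj₂ (refl , _)) → a∉ (u₂∈path {A}) }) ]′

      module _ {A B : List (Fin N)} (F : Frame A B) where
        open Frame F

        Out : Fin N → Set
        Out z = z ∉ path A × z ∉ path B

        OutEdge : Fin N → Fin N → Set
        OutEdge a b = E G a b ≡ true × Out a × Out b

        Out? : ∀ z → (z ∈ path A ⊎ z ∈ path B) ⊎ Out z
        Out? z with z ∈? path A | z ∈? path B
        ... | yes p | _     = inj₁ (inj₁ p)
        ... | no _  | yes q = inj₁ (inj₂ q)
        ... | no p  | no q  = inj₂ (p , q)

        hit : ∀ {S x t} → Reach G S x t → Out x → t ∈ path A →
          ∃₂ λ q s → Star OutEdge x q × Out q × E G q s ≡ true × (s ∈ path A ⊎ s ∈ path B) × s ∉ S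
        hit rrefl out t∈ = ⊥-elim (proj₁ out t∈)
        hit {x = x} (rstep {y = y} e y∉ r) out t∈ with Out? y
        ... | inj₁ on = x , y , ε , out , e , on , y∉
        ... | inj₂ out′ with hit r out′ t∈
        ... | q , s , st , rest = q , s , (e , out , out′) ◅ st , rest

        -- With three targets on the path, one survives the deletion of any two vertices. An
        -- interior vertex exists because the path is not e alone.
        landmarks : ∃[ L ] (Unique L × length L ≡ 3 × (∀ {z} → z ∈ L → z ∈ path A))
        landmarks = go A uA neA
          where
          go : ∀ C → Unique (path C) → ¬ OnList (path C) u₁ u₂ →
            ∃[ L ] (Unique L × length L ≡ 3 × (∀ {z} → z ∈ L → z ∈ path C))
          go [] _ ne = ⊥-elim (ne (inj₁ here))
          go (a ∷ C) u@(_ ∷ u′) _ = u₁ ∷ a ∷ u₂ ∷ [] ,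
            ∉⇒Unique-∷ (λ { (here p) → u₁∉ (here p) ; (there (here p)) → u₁≢u₂ p })
              (∉⇒Unique-∷ (λ { (here p) → Unique[x∷xs]⇒x∉xs u′ (∈-++⁺ʳ C (here p)) }) ([] ∷ [])) ,
            refl ,
            λ { (here p) → here p ; (there (here p)) → there (here p)
              ; (there (there (here refl))) → u₂∈path {a ∷ C} }
            where u₁∉ = Unique[x∷xs]⇒x∉xs u

        escape : ∀ S → length S ≤ 2 → ∀ {x} → Out x → x ∉ S →
          ∃₂ λ q s → Star OutEdge x q × Out q × E G q s ≡ true × (s ∈ path A ⊎ s ∈ path B) × s ∉ S
        escape S S≤2 {x} out x∉ with landmarks
        ... | L , uL , l3 , sub with fresh L S uL (subst (length S <_) (sym l3) (s≤s S≤2))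
        ... | t , t∈ , t∉ = hit (proj₂ 3conn S S≤2 x t x∉ t∉) out (sub t∈)

        abstract
          -- A vertex missed by both paths would reach them at three different vertices, since
          -- 3-connectivity gives a new attachment after those already found are deleted. Two of the
          -- three lie on one path, and the ears to them combine through `x`.
          cover : ∀ x → x ∈ path A ⊎ x ∈ path B
          cover x with Out? x
          ... | inj₁ on = on
          ... | inj₂ out
            with escape [] z≤n out (λ ())
          ... | q₁ , s₁ , st₁ , o₁ , e₁ , on₁ , _
            with escape (s₁ ∷ []) (s≤s z≤n) out (λ { (here refl) → [ proj₁ out , proj₂ out ]′ on₁ })
          ... | q₂ , s₂ , st₂ , o₂ , e₂ , on₂ , s₂∉
            with escape (s₁ ∷ s₂ ∷ []) ≤-refl out
                   (λ { (here refl) → [ proj₁ out , proj₂ out ]′ on₁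
                      ; (there (here refl)) → [ proj₁ out , proj₂ out ]′ on₂ })
          ... | q₃ , s₃ , st₃ , o₃ , e₃ , on₃ , s₃∉ = ⊥-elim (pigeon on₁ on₂ on₃)
            where
            OutEdge-sym : ∀ {a b} → OutEdge a b → OutEdge b a
            OutEdge-sym (e , p , q) = E-sym′ G e , q , p
            earB : ∀ {q s q′ s′} → Star OutEdge x q → Star OutEdge x q′ → Out q → Out q′ →
              E G q s ≡ true → E G q′ s′ ≡ true → s ≢ s′ → s ∈ path B → s′ ∈ path B → ⊥
            earB st st′ o o′ e e′ ne s∈ s′∈ =
              noOutsideEar F s∈ s′∈ ne (proj₁ o) (proj₂ o) (proj₁ o′) (reverse OutEdge-sym st ◅◅ st′) e e′
            earA : ∀ {q s q′ s′} → Star OutEdge x q → Star OutEdge x q′ → Out q → Out q′ →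
              E G q s ≡ true → E G q′ s′ ≡ true → s ≢ s′ → s ∈ path A → s′ ∈ path A → ⊥
            earA st st′ o o′ e e′ ne s∈ s′∈ =
              noOutsideEar (swapFrame F) s∈ s′∈ ne (proj₂ o) (proj₁ o) (proj₂ o′)
                (Star.map (λ { (e , (p , q) , (p′ , q′)) → e , (q , p) , (q′ , p′) })
                  (reverse OutEdge-sym st ◅◅ st′)) e e′
            1≢2 : s₁ ≢ s₂
            1≢2 p = s₂∉ (here (sym p))
            1≢3 : s₁ ≢ s₃
            1≢3 p = s₃∉ (here (sym p))
            2≢3 : s₂ ≢ s₃
            2≢3 p = s₃∉ (there (here (sym p)))
            pigeon : s₁ ∈ path A ⊎ s₁ ∈ path B → s₂ ∈ path A ⊎ s₂ ∈ path B → s₃ ∈ path A ⊎ s₃ ∈ path B → ⊥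
            pigeon (inj₁ p) (inj₁ q) _        = earA st₁ st₂ o₁ o₂ e₁ e₂ 1≢2 p q
            pigeon (inj₁ p) _        (inj₁ r) = earA st₁ st₃ o₁ o₃ e₁ e₃ 1≢3 p r
            pigeon _        (inj₁ q) (inj₁ r) = earA st₂ st₃ o₂ o₃ e₂ e₃ 2≢3 q r
            pigeon (inj₂ p) (inj₂ q) _        = earB st₁ st₂ o₁ o₂ e₁ e₂ 1≢2 p q
            pigeon (inj₂ p) _        (inj₂ r) = earB st₁ st₃ o₁ o₃ e₁ e₃ 1≢3 p r
            pigeon _        (inj₂ q) (inj₂ r) = earB st₂ st₃ o₂ o₃ e₂ e₃ 2≢3 q r

        neighbours : ∀ {x} → x ∈ A → ∃₂ λ p q → p ≢ x × q ≢ x × (∀ {y} → OnList (path A) x y → y ≡ p ⊎ y ≡ q)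
        neighbours {x} x∈ with ∈⇒at u₂ A x∈
        -- `k` counts within `A` but `pos` counts from `u₁`, so `x` is at position `k + 1`, between
        -- `k` and `k + 2`.
        ... | k , k< , refl = pos k , pos (suc (suc k)) , off , off′ , near
          where
          pos = at u₂ (u₁ ∷ A)
          inj : ∀ {i j} → i ≤ suc (length A) → j ≤ suc (length A) → pos i ≡ pos j → i ≡ j
          inj = at-injective-snoc u₂ (u₁ ∷ A) uA
          k≤ : suc k ≤ suc (length A)
          k≤ = m≤n⇒m≤1+n k<
          off : pos k ≢ pos (suc k)
          off p with inj (≤-trans (n≤1+n k) k≤) k≤ p
          ... | ()
          off′ : pos (suc (suc k)) ≢ pos (suc k)
          off′ p with inj (s≤s k<) k≤ p
          ... | ()
          near : ∀ {y} → OnList (path A) (pos (suc k)) y → y ≡ pos k ⊎ y ≡ pos (suc (suc k))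
          near (inj₁ c) with Consec-snoc⇒at u₂ (u₁ ∷ A) c
          ... | j , j< , p , refl with inj (≤-trans (n≤1+n j) j<) k≤ p
          ... | refl = inj₂ refl
          near (inj₂ c) with Consec-snoc⇒at u₂ (u₁ ∷ A) c
          ... | j , j< , refl , p with inj j< k≤ p
          ... | refl = inj₁ refl

        -- Without its two path neighbours, `x` must still reach a fourth vertex, so it has another
        -- neighbour. By `noChord` that one is not on the same path, hence by `cover` it is interior
        -- to the other.
        chord-exists : ∀ x → x ∈ A → ∃[ y ] (y ∈ B × E G x y ≡ true)
        chord-exists x x∈ with neighbours x∈
        ... | p , q , p≢x , q≢x , near with fresh³ x p q
        ... | z , z≢x , z≢p , z≢q
          with proj₂ 3conn (p ∷ q ∷ []) ≤-refl x z
                 (λ { (here r) → p≢x (sym r) ; (there (here r)) → q≢x (sym r) })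
                 (λ { (here r) → z≢p r ; (there (here r)) → z≢q r })
        ... | rrefl = ⊥-elim (z≢x refl)
        ... | rstep {y = y} e y∉ _ = y , inB (cover y) , e
          where
          notA : y ∉ path A
          notA y∈ with noChord (swapFrame F) (∈⇒∈-path x∈) y∈ e
          ... | inj₁ o = [ (λ r → y∉ (here r)) , (λ r → y∉ (there (here r))) ]′ (near o)
          ... | inj₂ (inj₁ (r , _)) = interior F x∈ (inj₁ r)
          ... | inj₂ (inj₂ (r , _)) = interior F x∈ (inj₂ r)
          inB : y ∈ path A ⊎ y ∈ path B → y ∈ B
          inB (inj₁ y∈) = ⊥-elim (notA y∈)
          inB (inj₂ y∈) with ∈-path⁻ y∈
          ... | inj₁ r = r
          ... | inj₂ r = ⊥-elim (notA (end∈path r))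

        -- Each interior vertex has a chord, and no vertex of `B` receives two, so chords inject `A`
        -- into `B`.
        length-A≤B : length A ≤ length B
        length-A≤B = length-≤ {R = λ x y → E G x y ≡ true} uniq chord-exists
          λ x x′ y x∈ x′∈ y∈ e e′ → chord-unique (swapFrame F) y∈ x∈ x′∈ (E-sym′ G e) (E-sym′ G e′)
          where
          uniq : Unique A
          uniq with uA
          ... | _ ∷ u = Unique-++⇒ˡ A u

      -- Follow the first path up to x, cross to y and follow the second path to the end:
      -- two chords among the vertices missed by this route would close a cycle disjoint from it.
      noDoubleCrossing : ∀ A₁ {A₂} B₁ {B₂ x y} → Frame (A₁ ++ x ∷ A₂) (B₁ ++ y ∷ B₂) → E G x y ≡ true →
        ∀ {p p′ q q′} → p ∈ A₂ → p′ ∈ A₂ → q ∈ B₁ → q′ ∈ B₁ → p ≢ p′ →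
        E G p q ≡ true → ¬ (E G p′ q′ ≡ true)
      noDoubleCrossing A₁ {A₂} B₁ {B₂} {x} {y} F e {p} {p′} {q} {q′} p∈ p′∈ q∈ q′∈ p≢p′ pq p′q′ =
        noPair (cyclePair G {R₁ = R₁} {R₂ = R₂}
          (λ { (e , a , b) → E-sym′ G e , b , a }) (λ { (e , a , b) → E-sym′ G e , b , a })
          proj₁ proj₁ (λ { (_ , a∉ , _) (_ , a∈ , _) → a∉ a∈ })
          (u₁u₂ , left∉ u₁∈left , right∉ u₂∈right)
          (Star.map leftEdge (OnList-connected left u₁∈left (there (∈-++⁺ʳ A₁ (here refl))))
            ◅◅ ((e , left∉ (there (∈-++⁺ʳ A₁ (here refl))) , right∉ (here refl)) ,
                λ { (inj₁ (r , _)) → interior F x∈A (inj₁ r) ; (inj₂ (r , _)) → interior F x∈A (inj₂ r) })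
            ◅ Star.map rightEdge (OnList-connected right (here refl) u₂∈right))
          -- The second cycle: the chord from `p` to `q`, closed by `A₂` from `p` to `p′`, the chord
          -- from `p′` to `q′`, and `B₁` back to `q`.
          (pq , ∈-++⁺ˡ p∈ , ∈-++⁺ʳ A₂ q∈)
          (Star.map edgeA₂ (OnList-connected A₂ p∈ p′∈)
            ◅◅ ((p′q′ , ∈-++⁺ˡ p′∈ , ∈-++⁺ʳ A₂ q′∈) ,
                λ { (inj₁ (r , _)) → p≢p′ (sym r) ; (inj₂ (refl , _)) → A∩B=∅ (inA p′∈) (inB q∈) })
            ◅ Star.map edgeB₁ (OnList-connected B₁ q′∈ q∈)))
        where
        open Frame F
        missed left right : List (Fin N)
        missed = A₂ ++ B₁
        left   = u₁ ∷ A₁ ++ [ x ]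
        right  = y ∷ B₂ ++ [ u₂ ]
        R₁ R₂ : Fin N → Fin N → Set
        R₁ a b = E G a b ≡ true × a ∉ missed × b ∉ missed
        R₂ a b = E G a b ≡ true × a ∈ missed × b ∈ missed
        splitA : left ++ A₂ ++ [ u₂ ] ≡ path (A₁ ++ x ∷ A₂)
        splitA = cong (u₁ ∷_) (trans (++-assoc A₁ [ x ] _) (sym (++-assoc A₁ (x ∷ A₂) [ u₂ ])))
        splitB : (u₁ ∷ B₁) ++ right ≡ path (B₁ ++ y ∷ B₂)
        splitB = cong (u₁ ∷_) (sym (++-assoc B₁ (y ∷ B₂) [ u₂ ]))
        inA : ∀ {z} → z ∈ A₂ → z ∈ A₁ ++ x ∷ A₂
        inA z∈ = ∈-++⁺ʳ A₁ (there z∈)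
        inB : ∀ {z} → z ∈ B₁ → z ∈ B₁ ++ y ∷ B₂
        inB = ∈-++⁺ˡ
        x∈A : x ∈ A₁ ++ x ∷ A₂
        x∈A = ∈-++⁺ʳ A₁ (here refl)
        u₁∈left : u₁ ∈ left
        u₁∈left = here refl
        u₂∈right : u₂ ∈ right
        u₂∈right = there (∈-++⁺ʳ B₂ (here refl))
        left∉ : ∀ {z} → z ∈ left → z ∉ missed
        left∉ {z} z∈ z∈m with ∈-++⁻ A₂ z∈m
        ... | inj₁ r = Unique-++⇒disjoint left (subst Unique (sym splitA) uA) z∈ (∈-++⁺ˡ r)
        ... | inj₂ r = A∉B-path (swapFrame F) (inB r) (subst (z ∈_) splitA (∈-++⁺ˡ z∈))
        right∉ : ∀ {z} → z ∈ right → z ∉ missed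
        right∉ {z} z∈ z∈m with ∈-++⁻ A₂ z∈m
        ... | inj₁ r = A∉B-path F (inA r) (subst (z ∈_) splitB (∈-++⁺ʳ (u₁ ∷ B₁) z∈))
        ... | inj₂ r = Unique-++⇒disjoint (u₁ ∷ B₁) (subst Unique (sym splitB) uB) (there r) z∈
        leftEdge : ∀ {a b} → OnList left a b → R₁ a b × ¬ UEdge u₁ u₂ a b
        leftEdge {a} {b} o = (OnA-E F o′ , left∉ (OnList-∈ˡ o) , left∉ (OnList-∈ʳ o)) , OnA⇒¬e F o′
          where
          o′ : OnList (path (A₁ ++ x ∷ A₂)) a b
          o′ = subst (λ L → OnList L a b) splitA (Sum.map Consec-++⁺ˡ Consec-++⁺ˡ o)
        rightEdge : ∀ {a b} → OnList right a b → R₁ a b × ¬ UEdge u₁ u₂ a b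
        rightEdge {a} {b} o =
          (OnA-E (swapFrame F) o′ , right∉ (OnList-∈ˡ o) , right∉ (OnList-∈ʳ o)) , OnA⇒¬e (swapFrame F) o′
          where
          o′ : OnList (path (B₁ ++ y ∷ B₂)) a b
          o′ = subst (λ L → OnList L a b) splitB (Sum.map (Consec-++⁺ʳ (u₁ ∷ B₁)) (Consec-++⁺ʳ (u₁ ∷ B₁)) o)
        edgeA₂ : ∀ {a b} → OnList A₂ a b → R₂ a b × ¬ UEdge p q a b
        edgeA₂ {a} {b} o =
          (OnA-E F (subst (λ L → OnList L a b) splitA (Sum.map lift lift o)) ,
            ∈-++⁺ˡ (OnList-∈ˡ o) , ∈-++⁺ˡ (OnList-∈ʳ o)) ,
          λ u → avoid∉ {xs = A₂} (λ q∈A → A∩B=∅ (inA q∈A) (inB q∈)) o (UEdge-flip u)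
          where
          lift : ∀ {a b} → Consec A₂ a b → Consec (left ++ A₂ ++ [ u₂ ]) a b
          lift c = Consec-++⁺ʳ left (Consec-++⁺ˡ c)
        edgeB₁ : ∀ {a b} → OnList B₁ a b → R₂ a b × ¬ UEdge p q a b
        edgeB₁ {a} {b} o =
          (OnA-E (swapFrame F) (subst (λ L → OnList L a b) splitB (Sum.map lift lift o)) ,
            ∈-++⁺ʳ A₂ (OnList-∈ˡ o) , ∈-++⁺ʳ A₂ (OnList-∈ʳ o)) ,
          avoid∉ {xs = B₁} (λ p∈B → A∩B=∅ (inA p∈) (inB p∈B)) o
          where
          lift : ∀ {a b} → Consec B₁ a b → Consec ((u₁ ∷ B₁) ++ right) a b
          lift c = there (Consec-++⁺ˡ c)

      -- The matching between the interiors and its permutation.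

      module _ {n : ℕ} (v : Fin n → Fin N) (w : Fin n → Fin N) (F : Frame (tabulate v) (tabulate w)) where

        abstract
          partner : ∀ i → ∃[ j ] E G (v i) (w j) ≡ true
          partner i with chord-exists F (v i) (∈-tabulate⁺ i)
          ... | y , y∈ , e with ∈-tabulate⁻ y∈
          ... | j , refl = j , e

        tabulate-injective : ∀ {i j} → v i ≡ v j → i ≡ j
        tabulate-injective {i} {j} eq = toℕ-injective (suc-injective
          (at-injective-snoc u₂ (u₁ ∷ tabulate v) (Frame.uA F) (bound i) (bound j)
            (trans (at-tabulate u₂ v i) (trans eq (sym (at-tabulate u₂ v j))))))
          where
          bound : ∀ k → suc (toℕ k) ≤ suc (length (tabulate v))
          bound k = s≤s (subst (toℕ k ≤_) (sym (length-tabulate v)) (≤-trans (n≤1+n _) (toℕ<n k)))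

      -- By uniqueness of chords the chosen partner is the only one; hence the choices made from the
      -- two sides are inverse permutations.
      chord⇒partner : ∀ {n} (v : Fin n → Fin N) (w : Fin n → Fin N) (F : Frame (tabulate v) (tabulate w)) →
        ∀ {i j} → E G (v i) (w j) ≡ true → proj₁ (partner v w F i) ≡ j
      chord⇒partner v w F {i} {j} e = tabulate-injective w v (swapFrame F)
        (chord-unique F (∈-tabulate⁺ i) (∈-tabulate⁺ _) (∈-tabulate⁺ j) (proj₂ (partner v w F i)) e)

      -- Both paths are split at the chord of `i`. An inversion is a chord from the part after `v i`
      -- to the part before the partner of `v i`, and `noDoubleCrossing` forbids two of these.
      partner-fewInversions : ∀ {n} (v : Fin n → Fin N) (w : Fin n → Fin N) (F : Frame (tabulate v) (tabulate w)) →
        FewInversions (λ i → proj₁ (partner v w F i))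
      partner-fewInversions v w F {i} {j} {j′} i<j i<j′ j≢j′ σj< σj′<
        with tabulate-split v i | tabulate-split w (proj₁ (partner v w F i))
      ... | A₁ , A₂ , eqA , _ , after | B₁ , B₂ , eqB , before , _ =
        noDoubleCrossing A₁ B₁ (subst₂ Frame eqA eqB F) (proj₂ (partner v w F i))
          (after j i<j) (after j′ i<j′) (before _ σj<) (before _ σj′<)
          (λ p → j≢j′ (tabulate-injective v w F p))
          (proj₂ (partner v w F j)) (proj₂ (partner v w F j′))

      frame⇒structure : ∀ {n} (v : Fin n → Fin N) (w : Fin n → Fin N) → Frame (tabulate v) (tabulate w) →
        Structure G u₁ u₂
      frame⇒structure {n} v w F =
        n , v , w , P ,
        (uA , λ a b → adjA) , (uB , λ a b → adjB) ,
        (λ i j p → A∩B=∅ (∈-tabulate⁺ i) (subst (_∈ tabulate w) (sym p) (∈-tabulate⁺ j))) ,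
        neA , neB , (P-bounded , P-disjoint) , cover F , λ x y → classify x y , realise x y
        where
        open Frame F
        σ τ : Fin n → Fin n
        σ i = proj₁ (partner v w F i)
        τ j = proj₁ (partner w v (swapFrame F) j)
        σ-edge : ∀ i → E G (v i) (w (σ i)) ≡ true
        σ-edge i = proj₂ (partner v w F i)
        στ : ∀ j → σ (τ j) ≡ j
        στ j = chord⇒partner v w F (E-sym′ G (proj₂ (partner w v (swapFrame F) j)))
        τσ : ∀ i → τ (σ i) ≡ i
        τσ i = chord⇒partner w v (swapFrame F) (E-sym′ G (σ-edge i))
        adjacent : ∀ i → AdjacentSwap σ τ i
        adjacent = adjacentSwaps στ τσ (partner-fewInversions v w F) (partner-fewInversions w v (swapFrame F))
        σσ : ∀ i → σ (σ i) ≡ i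
        σσ i = trans (proj₁ (adjacent (σ i))) (τσ i)

        P : Fin n → Bool
        -- A swapped pair is marked at its lower index only, where `σ` moves up.
        P i = isYes (toℕ (σ i) ℕ.≟ suc (toℕ i))
        P⁻ : ∀ {i} → P i ≡ true → toℕ (σ i) ≡ suc (toℕ i)
        P⁻ {i} p with toℕ (σ i) ℕ.≟ suc (toℕ i)
        ... | yes q = q
        P⁺ : ∀ {i} → toℕ (σ i) ≡ suc (toℕ i) → P i ≡ true
        P⁺ {i} p with toℕ (σ i) ℕ.≟ suc (toℕ i)
        ... | yes q = refl
        ... | no ¬q = ⊥-elim (¬q p)
        ¬P⁺ : ∀ {i} → toℕ (σ i) ≢ suc (toℕ i) → P i ≡ false
        ¬P⁺ {i} p with toℕ (σ i) ℕ.≟ suc (toℕ i)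
        ... | yes q = ⊥-elim (p q)
        ... | no ¬q = refl
        P-next : ∀ {i j} → toℕ j ≡ suc (toℕ i) → P i ≡ true → σ i ≡ j × σ j ≡ i
        P-next {i} {j} j≡ p = σi≡j , trans (cong σ (sym σi≡j)) (σσ i)
          where
          σi≡j : σ i ≡ j
          σi≡j = toℕ-injective (trans (P⁻ p) (sym j≡))

        P-bounded : ∀ i → P i ≡ true → suc (toℕ i) < n
        P-bounded i p = subst (_< n) (P⁻ p) (toℕ<n (σ i))
        P-disjoint : ∀ i j → toℕ j ≡ suc (toℕ i) → P i ≡ true → P j ≡ false
        P-disjoint i j j≡ p = ¬P⁺ λ q → <-irrefl (trans (sym (cong toℕ (proj₂ (P-next j≡ p)))) q)
          (s≤s (subst (toℕ i ≤_) (sym j≡) (n≤1+n _)))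

        Crossed Rung : Fin N → Fin N → Set
        Crossed x y = ∃[ i ] ∃[ j ] (P i ≡ true × toℕ j ≡ suc (toℕ i) ×
          (UEdge (v i) (w j) x y ⊎ UEdge (v j) (w i) x y))
        Rung x y = ∃[ k ] (Uncovered {N} P k × UEdge (v k) (w k) x y)

        -- A chord going up belongs to the pair marked at `i`, one going down to the pair marked at
        -- `σ i`; in the latter case `i` is `σ i + 1` by the bound at `σ i`, as `σ` is an
        -- involution.
        chordKind : ∀ i → Crossed (v i) (w (σ i)) ⊎ Rung (v i) (w (σ i))
        chordKind i with <-cmp (toℕ i) (toℕ (σ i))
        ... | tri< lt _ _ = inj₁ (i , σ i , P⁺ eq , eq , inj₁ (inj₁ (refl , refl)))
          where
          eq : toℕ (σ i) ≡ suc (toℕ i)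
          eq = ≤-antisym (proj₂ (adjacent i)) lt
        ... | tri> _ _ gt = inj₁ (σ i , i , P⁺ (trans (cong toℕ (σσ i)) eq) , eq , inj₂ (inj₁ (refl , refl)))
          where
          eq : toℕ i ≡ suc (toℕ (σ i))
          eq = ≤-antisym (subst (λ k → toℕ k ≤ suc (toℕ (σ i))) (σσ i) (proj₂ (adjacent (σ i)))) gt
        ... | tri≈ _ eq _ = inj₂ (i , (¬P⁺ (λ q → 1+n≢ (trans eq q)) , notAfter) ,
                             inj₁ (refl , cong w (sym (toℕ-injective eq))))
          where
          1+n≢ : ∀ {m} → m ≢ suc m
          1+n≢ ()
          notAfter : ∀ j → toℕ i ≡ suc (toℕ j) → P j ≡ false
          notAfter j i≡ = ¬P⁺ λ q → 1+n≢ (trans (cong toℕ (trans (sym (σσ j))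
            (trans (cong σ (toℕ-injective (trans q (sym i≡)))) (sym (toℕ-injective eq))))) i≡)

        Kind : Fin N → Fin N → Set
        Kind x y = Crossed x y ⊎ Rung x y ⊎ OnList (path (tabulate v)) x y ⊎
          OnList (path (tabulate w)) x y ⊎ UEdge u₁ u₂ x y

        Kind-sym : ∀ {x y} → Crossed x y ⊎ Rung x y → Kind y x
        Kind-sym (inj₁ (i , j , p , q , u)) = inj₁ (i , j , p , q , Sum.map UEdge-sym UEdge-sym u)
        Kind-sym (inj₂ (k , c , u))         = inj₂ (inj₁ (k , c , UEdge-sym u))

        chord : ∀ {x y} → x ∈ tabulate v → y ∈ tabulate w → E G x y ≡ true → Crossed x y ⊎ Rung x y
        chord x∈ y∈ e with ∈-tabulate⁻ x∈ | ∈-tabulate⁻ y∈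
        ... | i , refl | j , refl = subst (λ k → Crossed (v i) (w k) ⊎ Rung (v i) (w k))
                                      (chord⇒partner v w F e) (chordKind i)

        withinA : ∀ {x y} → x ∈ path (tabulate v) → y ∈ path (tabulate v) → E G x y ≡ true → Kind x y
        withinA x∈ y∈ e = inj₂ (inj₂ (Sum.map₂ inj₂ (noChord (swapFrame F) x∈ y∈ e)))
        withinB : ∀ {x y} → x ∈ path (tabulate w) → y ∈ path (tabulate w) → E G x y ≡ true → Kind x y
        withinB x∈ y∈ e = inj₂ (inj₂ (inj₂ (noChord F x∈ y∈ e)))

        -- `u₁` and `u₂` lie on both paths, so an edge at either of them has both ends on a single
        -- path. Only edges between the two interiors are chords.
        classify : ∀ x y → E G x y ≡ true → Kind x y
        classify x y e with cover F x | cover F y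
        ... | inj₁ xA | inj₁ yA = withinA xA yA e
        ... | inj₂ xB | inj₂ yB = withinB xB yB e
        ... | inj₁ xA | inj₂ yB with ∈-path⁻ xA | ∈-path⁻ yB
        ... | inj₂ x≡ | _       = withinB (end∈path x≡) yB e
        ... | inj₁ _  | inj₂ y≡ = withinA xA (end∈path y≡) e
        ... | inj₁ x∈ | inj₁ y∈ = Sum.map₂ inj₁ (chord x∈ y∈ e)
        classify x y e | inj₂ xB | inj₁ yA with ∈-path⁻ xB | ∈-path⁻ yA
        ... | inj₂ x≡ | _       = withinA (end∈path x≡) yA e
        ... | inj₁ _  | inj₂ y≡ = withinB xB (end∈path y≡) e
        ... | inj₁ x∈ | inj₁ y∈ = Kind-sym (chord y∈ x∈ (E-sym′ G e))

        UEdge-E : ∀ {a b x y} → E G a b ≡ true → UEdge a b x y → E G x y ≡ true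
        UEdge-E e (inj₁ (refl , refl)) = e
        UEdge-E e (inj₂ (refl , refl)) = E-sym′ G e

        true≢false : true ≢ false
        true≢false ()
        -- If `σ` moved `k`, then `k` would be the lower or the upper member of a marked pair.
        rung-fixed : ∀ k → Uncovered {N} P k → σ k ≡ k
        rung-fixed k (¬Pk , ¬P<k) = go (<-cmp (toℕ k) (toℕ (σ k)))
          where
          go : Tri (toℕ k < toℕ (σ k)) (toℕ k ≡ toℕ (σ k)) (toℕ k ℕ.> toℕ (σ k)) → σ k ≡ k
          go (tri≈ _ eq _) = sym (toℕ-injective eq)
          go (tri< lt _ _) = ⊥-elim (true≢false (trans (sym (P⁺ (≤-antisym (proj₂ (adjacent k)) lt))) ¬Pk))
          go (tri> _ _ gt) = ⊥-elim (true≢false (trans (sym (P⁺ (trans (cong toℕ (σσ k)) eq))) (¬P<k (σ k) eq)))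
            where
            eq : toℕ k ≡ suc (toℕ (σ k))
            eq = ≤-antisym (subst (λ j → toℕ j ≤ suc (toℕ (σ k))) (σσ k) (proj₂ (adjacent (σ k)))) gt

        realise : ∀ x y → Kind x y → E G x y ≡ true
        realise x y (inj₁ (i , j , p , j≡ , u)) =
          [ UEdge-E (subst (λ k → E G (v i) (w k) ≡ true) (proj₁ (P-next j≡ p)) (σ-edge i))
          , UEdge-E (subst (λ k → E G (v j) (w k) ≡ true) (proj₂ (P-next j≡ p)) (σ-edge j)) ]′ u
        realise x y (inj₂ (inj₁ (k , unc , u))) =
          UEdge-E (subst (λ j → E G (v k) (w j) ≡ true) (rung-fixed k unc) (σ-edge k)) u
        realise x y (inj₂ (inj₂ (inj₁ o)))               = OnA-E F o
        realise x y (inj₂ (inj₂ (inj₂ (inj₁ o))))        = OnA-E (swapFrame F) o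
        realise x y (inj₂ (inj₂ (inj₂ (inj₂ u))))        = UEdge-E u₁u₂ u

      noPair⇒structure : Structure G u₁ u₂
      noPair⇒structure with frame
      ... | A , B , F = frame⇒structure v (lookup B)
        (subst₂ Frame A≡ (sym (tabulate-lookup B)) F)
        where
        fromLength : ∀ (xs : List (Fin N)) {m} → length xs ≡ m → ∃[ p ] (xs ≡ tabulate {n = m} p)
        fromLength xs refl = lookup xs , sym (tabulate-lookup xs)
        -- `length-A≤B` for the frame and its swap gives equal lengths, so both interiors can be
        -- indexed by the same `Fin`.
        byLength : ∃[ p ] (A ≡ tabulate {n = length B} p)
        byLength = fromLength A (≤-antisym (length-A≤B F) (length-A≤B (swapFrame F)))
        v  = proj₁ byLength
        A≡ = proj₂ byLength

  -- How a cycle meets a cut.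

  noBacktrack : ∀ {c} {x y : Fin N} → 3 ≤ length c → Unique c → Consec (close c) x y → ¬ Consec (close c) y x
  noBacktrack {c@(z ∷ zs)} l u e e′ with Consec-snoc⇒at z c e | Consec-snoc⇒at z c e′
  ... | k , k< , refl , refl | k′ , k′< , p , q = go (m≤n⇒m<n∨m≡n k<)
    where
    pos = at z c
    inj : ∀ {i j} → i < length c → j < length c → pos i ≡ pos j → i ≡ j
    inj = at-injective z c u
    0< : 0 < length c
    0< = s≤s z≤n
    wrap : ∀ {i} → i ≡ length c → pos i ≡ pos 0
    wrap refl = at-length z zs
    length≢2 : 2 ≢ length c
    length≢2 eq = 1+n≰n (subst (3 ≤_) (sym eq) l)
    -- The reversed step has to start at position `k + 1` and end at position `k`, read cyclically;
    -- so two steps go once around and the length is 2.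
    go : suc k < length c ⊎ suc k ≡ length c → ⊥
    go (inj₁ k+1<) with inj k′< k+1< p
    ... | refl with m≤n⇒m<n∨m≡n k′<
    ... | inj₁ k+2< with inj k+2< k< q
    ... | ()
    go (inj₁ k+1<) | refl | inj₂ k+2≡ with inj 0< k< (trans (sym (wrap k+2≡)) q)
    ... | refl = length≢2 k+2≡
    go (inj₂ k+1≡) with inj k′< 0< (trans p (wrap k+1≡))
    ... | refl with inj (≤-trans (s≤s (s≤s z≤n)) l) k< q
    ... | refl = length≢2 k+1≡

  firstCrossing : ∀ (f : Fin N → Bool) {b p q} xs → f p ≡ not b → q ∈ p ∷ xs → f q ≡ b →
    ∃₂ λ s t → Consec (p ∷ xs) s t × f s ≡ not b × f t ≡ b
  firstCrossing f {b} xs fp (here refl) fq = ⊥-elim (not-¬ refl (trans (sym fq) fp))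
  firstCrossing f {b} (r ∷ xs) fp (there q∈) fq with f r Bool.≟ b
  ... | yes fr = _ , r , here , fp , fr
  ... | no  fr with firstCrossing f xs (¬-not fr) q∈ fq
  ... | s , t , c , rest = s , t , there c , rest

  -- A closed walk that leaves a side must come back. If the base point `z` lies on the side of `y`,
  -- the return is found between `z` and `x`; otherwise it is found between `y` and the final `z`.
  recross : ∀ (f : Fin N → Bool) {b} c {x y} → Consec (close c) x y → f x ≡ b → f y ≡ not b →
    ∃₂ λ s t → Consec (close c) s t × f s ≡ not b × f t ≡ b
  recross f {b} (z ∷ zs) {x} {y} e fx fy with f z Bool.≟ b
  ... | no fz = firstCrossing f (zs ++ [ z ]) (¬-not fz) (Consec-∈ˡ e) fx
  ... | yes fz = later (z ∷ zs) e
    where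
    later : ∀ xs → Consec (xs ++ [ z ]) x y → ∃₂ λ s t → Consec (xs ++ [ z ]) s t × f s ≡ not b × f t ≡ b
    later [] (there ())
    later (a ∷ []) here = ⊥-elim (not-¬ refl (trans (sym fz) fy))
    later (a ∷ a′ ∷ xs) here with firstCrossing f (xs ++ [ z ]) fy (there (∈-++⁺ʳ xs (here refl))) fz
    ... | s , t , c , rest = s , t , there c , rest
    later (a ∷ xs@(_ ∷ _)) (there e) with later xs e
    ... | s , t , c , rest = s , t , there c , rest
    later (a ∷ []) (there (there ()))

  -- The return passes the cut in the opposite direction, so by `noBacktrack` it is a different
  -- edge.
  cut : ∀ (G : Graph N) {c} → IsCycle G c → (f : Fin N → Bool) → ∀ {x y} → CycEdge c x y →
    f x ≡ true → f y ≡ false →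
    ∃₂ λ s t → CycEdge c s t × f s ≡ true × f t ≡ false × ¬ (s ≡ x × t ≡ y)
  cut G {c} (l , u , _) f (inj₁ e) fx fy with recross f c e fx fy
  ... | s , t , e′ , fs , ft = t , s , inj₂ e′ , ft , fs , λ { (refl , refl) → noBacktrack l u e e′ }
  cut G {c} (l , u , _) f (inj₂ e) fx fy with recross f c e fy fx
  ... | s , t , e′ , fs , ft = s , t , inj₁ e′ , fs , ft , λ { (refl , refl) → noBacktrack l u e e′ }

  CycEdge⇒E : ∀ (G : Graph N) {c} → IsCycle G c → ∀ {x y} → CycEdge c x y → E G x y ≡ true
  CycEdge⇒E G (_ , _ , adj) (inj₁ e) = adj _ _ e
  CycEdge⇒E G (_ , _ , adj) (inj₂ e) = E-sym′ G (adj _ _ e)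

  -- The cut around the single vertex `x`: a cycle has a second edge there.
  fork : ∀ (G : Graph N) {c} → IsCycle G c → ∀ {x y} → CycEdge c x y → ∃[ y′ ] (CycEdge c x y′ × y′ ≢ y)
  fork G {c} cyc {x} {y} e
    with cut G cyc (λ z → isYes (z ≟ x)) e (dec-isYes refl) (dec-isNo (λ p → E⇒≢ G (CycEdge⇒E G cyc e) (sym p)))
    where
    dec-isYes : ∀ {z} → z ≡ x → isYes (z ≟ x) ≡ true
    dec-isYes {z} p with z ≟ x
    ... | yes _ = refl
    ... | no ¬p = ⊥-elim (¬p p)
    dec-isNo : ∀ {z} → z ≢ x → isYes (z ≟ x) ≡ false
    dec-isNo {z} ¬p with z ≟ x
    ... | yes p = ⊥-elim (¬p p)
    ... | no _  = refl
  ... | s , t , e′ , fs , _ , ne with s ≟ x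
  ... | yes refl = t , e′ , λ p → ne (refl , p)

  -- The ladder: levels, sides and gaps.

  module Ladder (G : Graph N) (u₁ u₂ : Fin N) {n : ℕ} (p : Bool → Fin n → Fin N) (P : Fin n → Bool)
    (unique   : ∀ b → Unique (pathList u₁ (p b) u₂))
    (disjoint : ∀ i j → p true i ≢ p false j)
    (valid    : ValidFamily {N} n P)
    (cover    : ∀ x → ∃[ b ] x ∈ pathList u₁ (p b) u₂) where

    -- Level 0 is u₁ and level n + 1 is u₂, on both sides.
    q : Bool → ℕ → Fin N
    q b = at u₂ (u₁ ∷ tabulate (p b))

    -- Refers to the gap between levels `k` and `k + 1`, which carries the mark of index `k - 1`
    -- since levels are shifted by one. The gap above `u₁` is uncrossed, and so is everything past
    -- the last index.
    crossed : ℕ → Bool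
    crossed zero    = false
    crossed (suc k) = at false (tabulate P) k

    q-end : ∀ b → q b (suc n) ≡ u₂
    q-end b = subst (λ m → q b (suc m) ≡ u₂) (length-tabulate (p b)) (at-length u₂ (tabulate (p b)))

    q-interior : ∀ b {k} (k<n : k < n) → q b (suc k) ≡ p b (fromℕ< k<n)
    q-interior b k<n = subst (λ m → q b (suc m) ≡ p b (fromℕ< k<n)) (toℕ-fromℕ< k<n) (at-tabulate u₂ (p b) _)

    q-injective : ∀ b {j k} → j ≤ suc n → k ≤ suc n → q b j ≡ q b k → j ≡ k
    q-injective b j≤ k≤ = at-injective-snoc u₂ (u₁ ∷ tabulate (p b)) (unique b) (bound j≤) (bound k≤)
      where
      bound : ∀ {i} → i ≤ suc n → i ≤ suc (length (tabulate (p b)))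
      bound {i} = subst (λ m → i ≤ suc m) (sym (length-tabulate (p b)))

    q-true-false : ∀ {j k} → j ≤ suc n → k ≤ suc n → q true j ≡ q false k → j ≡ k
    q-true-false {zero} j≤ k≤ eq = q-injective false z≤n k≤ eq
    q-true-false {suc j} {zero} j≤ k≤ eq = q-injective true j≤ z≤n eq
    q-true-false {suc j} {suc k} (s≤s j≤) (s≤s k≤) eq with m≤n⇒m<n∨m≡n j≤ | m≤n⇒m<n∨m≡n k≤
    ... | inj₁ j< | inj₁ k< =
      ⊥-elim (disjoint _ _ (trans (sym (q-interior true j<)) (trans eq (q-interior false k<))))
    ... | inj₂ refl | _ = q-injective false ≤-refl (s≤s k≤) (trans (q-end false) (trans (sym (q-end true)) eq))
    ... | _ | inj₂ refl = q-injective true (s≤s j≤) ≤-refl (trans eq (trans (q-end false) (sym (q-end true))))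

    -- A vertex determines its level even though `u₁` and `u₂` occur on both sides; the side is
    -- determined only at interior levels, by `q-side`.
    q-level : ∀ b b′ {j k} → j ≤ suc n → k ≤ suc n → q b j ≡ q b′ k → j ≡ k
    q-level true  true  j≤ k≤ eq = q-injective true j≤ k≤ eq
    q-level false false j≤ k≤ eq = q-injective false j≤ k≤ eq
    q-level true  false j≤ k≤ eq = q-true-false j≤ k≤ eq
    q-level false true  j≤ k≤ eq = sym (q-true-false k≤ j≤ (sym eq))

    q-side : ∀ b b′ {k} → k < n → q b (suc k) ≡ q b′ (suc k) → b ≡ b′
    q-side true  true  _  _  = refl
    q-side false false _  _  = refl
    q-side true  false k< eq = ⊥-elim (disjoint _ _ (trans (sym (q-interior true k<)) (trans eq (q-interior false k<))))
    q-side false true  k< eq = ⊥-elim (disjoint _ _ (trans (sym (q-interior true k<)) (trans (sym eq) (q-interior false k<))))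

    abstract
      level-of : ∀ x → ∃₂ λ b k → k ≤ suc n × q b k ≡ x
      level-of x with cover x
      ... | b , x∈ with ∈-snoc⇒at u₂ (u₁ ∷ tabulate (p b)) x∈
      ... | k , k≤ , eq = b , k , subst (λ m → k ≤ suc m) (length-tabulate (p b)) k≤ , eq

    lev : Fin N → ℕ
    lev x = proj₁ (proj₂ (level-of x))

    lev-q : ∀ b {k} → k ≤ suc n → lev (q b k) ≡ k
    lev-q b {k} k≤ with level-of (q b k)
    ... | b′ , j , j≤ , eq = q-level b′ b j≤ k≤ eq

    crossed⁻ : ∀ {k} → crossed k ≡ true → ∃[ i ] (k ≡ suc (toℕ i) × P i ≡ true)
    crossed⁻ {suc k} eq with go P k eq
      where
      go : ∀ {m} (Q : Fin m → Bool) k → at false (tabulate Q) k ≡ true → ∃[ i ] (k ≡ toℕ i × Q i ≡ true)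
      go {suc m} Q zero    eq = zero , refl , eq
      go {suc m} Q (suc k) eq with go (Q ∘ suc) k eq
      ... | i , refl , Qi = suc i , refl , Qi
    ... | i , refl , Pi = i , refl , Pi

    crossed-bound : ∀ {k} → crossed k ≡ true → k < n
    crossed-bound {k} ck with crossed⁻ {k} ck
    ... | i , refl , Pi = proj₁ valid i Pi

    crossed-pos : ∀ {k} → crossed k ≡ true → ∃[ j ] k ≡ suc j
    crossed-pos {suc j} _ = j , refl

    crossed-suc : ∀ {k} → crossed k ≡ true → crossed (suc k) ≡ false
    crossed-suc {k} ck = ¬-not contra
      where
      contra : crossed (suc k) ≢ true
      contra ck′ with crossed⁻ {k} ck | crossed⁻ {suc k} ck′
      ... | i , k≡ , Pi | j , eq , Pj =
        not-¬ refl (trans (sym Pj) (proj₂ valid i j (trans (sym (suc-injective eq)) k≡) Pi))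

    crossed-pred : ∀ {k} → crossed (suc k) ≡ true → crossed k ≡ false
    crossed-pred {k} ck = ¬-not λ ck′ → not-¬ refl (trans (sym ck) (crossed-suc {k} ck′))

    -- Path edges and diagonals together, directed from `u₁` towards `u₂`. At a crossed gap all four
    -- combinations of sides occur, the edges of a 4-cycle.
    Up : Fin N → Fin N → Set
    Up x y = ∃[ k ] ∃[ b ] ∃[ b′ ] (k ≤ n × (b ≡ b′ ⊎ crossed k ≡ true) × x ≡ q b k × y ≡ q b′ (suc k))

    Rung : Fin N → Fin N → Set
    Rung x y = ∃[ k ] ∃[ b ] (k < n × crossed (suc k) ≡ false × crossed k ≡ false ×
      x ≡ q b (suc k) × y ≡ q (not b) (suc k))

    -- Excluding the second cycle edge by edge.

    module _ (classify : ∀ {x y} → E G x y ≡ true → Up x y ⊎ Up y x ⊎ Rung x y ⊎ UEdge u₁ u₂ x y)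
      {c₁ c₂ : List (Fin N)} (cyc₁ : IsCycle G c₁) (cyc₂ : IsCycle G c₂)
      (dis : ∀ x y → CycEdge c₁ x y → ¬ CycEdge c₂ x y) (e∈c₁ : CycEdge c₁ u₁ u₂) where

      below : ℕ → Fin N → Bool
      below k x = isYes (lev x ≤? k)

      below⁺ : ∀ {k x} → lev x ≤ k → below k x ≡ true
      below⁺ {k} {x} le with lev x ≤? k
      ... | yes _ = refl
      ... | no ¬p = ⊥-elim (¬p le)

      below⁻ : ∀ {k x} → below k x ≡ true → lev x ≤ k
      below⁻ {k} {x} eq with lev x ≤? k
      ... | yes le = le

      above⁺ : ∀ {k x} → k < lev x → below k x ≡ false
      above⁺ {k} {x} lt with lev x ≤? k
      ... | yes p = ⊥-elim (<⇒≱ lt p)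
      ... | no _  = refl

      above⁻ : ∀ {k x} → below k x ≡ false → k < lev x
      above⁻ {k} {x} eq with lev x ≤? k
      ... | no ¬p = ≰⇒> ¬p

      lev-u₁ : lev u₁ ≡ 0
      lev-u₁ = lev-q true z≤n

      lev-u₂ : lev u₂ ≡ suc n
      lev-u₂ = trans (cong lev (sym (q-end true))) (lev-q true ≤-refl)

      -- Path edges and diagonals climb exactly one level and rungs stay in theirs, so apart from e
      -- a cut is crossed only from level `k` to level `k + 1`.
      crossing : ∀ {k s t} → k ≤ n → E G s t ≡ true → below k s ≡ true → below k t ≡ false →
        ¬ (s ≡ u₁ × t ≡ u₂) →
        ∃₂ λ b b′ → (b ≡ b′ ⊎ crossed k ≡ true) × s ≡ q b k × t ≡ q b′ (suc k)
      crossing {k} k≤n e fs ft ne with classify e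
      ... | inj₁ (j , b , b′ , j≤n , str , refl , refl) = b , b′ ,
            subst (λ i → (b ≡ b′ ⊎ crossed i ≡ true) × q b j ≡ q b i × q b′ (suc j) ≡ q b′ (suc i)) j≡k (str , refl , refl)
        where
        j≡k : j ≡ k
        j≡k = ≤-antisym (subst (_≤ k) (lev-q b (m≤n⇒m≤1+n j≤n)) (below⁻ fs))
                (≤-pred (subst (k <_) (lev-q b′ (s≤s j≤n)) (above⁻ ft)))
      ... | inj₂ (inj₁ (j , b , b′ , j≤n , _ , refl , refl)) =
        ⊥-elim (<⇒≱ (subst (k <_) (lev-q b (m≤n⇒m≤1+n j≤n)) (above⁻ ft))
          (≤-trans (n≤1+n j) (subst (_≤ k) (lev-q b′ (s≤s j≤n)) (below⁻ fs))))
      ... | inj₂ (inj₂ (inj₁ (j , b , j<n , _ , _ , refl , refl))) =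
        ⊥-elim (<⇒≱ (subst (k <_) (lev-q (not b) (m≤n⇒m≤1+n j<n)) (above⁻ ft))
          (subst (_≤ k) (lev-q b (m≤n⇒m≤1+n j<n)) (below⁻ fs)))
      ... | inj₂ (inj₂ (inj₂ (inj₁ st≡))) = ⊥-elim (ne st≡)
      ... | inj₂ (inj₂ (inj₂ (inj₂ (refl , _)))) =
        ⊥-elim (<⇒≱ (s≤s k≤n) (subst (_≤ k) lev-u₂ (below⁻ fs)))

      -- Each cut separates `u₁` from `u₂`, so e crosses it and `cut` gives another edge of `c₁`.
      c₁-crosses : ∀ {k} → k ≤ n → ∃₂ λ b b′ → (b ≡ b′ ⊎ crossed k ≡ true) × CycEdge c₁ (q b k) (q b′ (suc k))
      c₁-crosses {k} k≤n
        with cut G cyc₁ (below k) e∈c₁ (below⁺ (subst (_≤ k) (sym lev-u₁) z≤n))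
               (above⁺ (subst (k <_) (sym lev-u₂) (s≤s k≤n)))
      ... | s , t , st , fs , ft , ne with crossing k≤n (CycEdge⇒E G cyc₁ st) fs ft ne
      ... | b , b′ , str , refl , refl = b , b′ , str , st

      c₂-avoids-e : ∀ {x y} → CycEdge c₂ x y → ¬ UEdge u₁ u₂ x y
      c₂-avoids-e e (inj₁ (refl , refl)) = dis _ _ e∈c₁ e
      c₂-avoids-e e (inj₂ (refl , refl)) = dis _ _ e∈c₁ (swap e)

      -- Besides e only the two path edges span an uncrossed gap. `c₂` would need both, but `c₁`
      -- takes one of them.
      noStraight : ∀ {k b b′} → k ≤ n → crossed k ≡ false → b ≡ b′ → ¬ CycEdge c₂ (q b k) (q b′ (suc k))
      noStraight {k} {b} k≤n ¬ck refl e
        with cut G cyc₂ (below k) e (below⁺ (subst (_≤ k) (sym (lev-q b (m≤n⇒m≤1+n k≤n))) ≤-refl))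
               (above⁺ (subst (k <_) (sym (lev-q b (s≤s k≤n))) ≤-refl))
      ... | s , t , st , fs , ft , ne
        with crossing k≤n (CycEdge⇒E G cyc₂ st) fs ft (λ p → c₂-avoids-e st (inj₁ p)) | c₁-crosses k≤n
      ... | _ , _ , inj₂ ck , _ | _ = not-¬ refl (trans (sym ck) ¬ck)
      ... | _ | _ , _ , inj₂ ck , _ = not-¬ refl (trans (sym ck) ¬ck)
      ... | b₂ , _ , inj₁ refl , refl , refl | b₁ , _ , inj₁ refl , e₁ with b₁ Bool.≟ b
      ... | yes refl = dis _ _ e₁ e
      ... | no b₁≢b with trans (¬-not b₁≢b) (sym (¬-not b₂≢b))
        where
        b₂≢b : b₂ ≢ b
        b₂≢b refl = ne (refl , refl)
      ... | refl = dis _ _ e₁ st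

      -- `c₂` needs a second edge at the lower vertex. The gap below is uncrossed and thus closed to
      -- `c₂` by `noStraight`, and a swapped level has no rung; only the other edge into the crossed
      -- gap remains. `forkDown` is the mirror image at the upper vertex.
      forkUp : ∀ {k b b′} → crossed k ≡ true → CycEdge c₂ (q b k) (q b′ (suc k)) →
        CycEdge c₂ (q b k) (q (not b′) (suc k))
      forkUp {k} {b} {b′} ck e with crossed-pos {k} ck | fork G cyc₂ e
      ... | m , refl | y , e′ , y≢ with classify (CycEdge⇒E G cyc₂ e′)
      ... | inj₁ (j , d , d′ , j≤n , _ , x≡ , refl)
            with q-level b d (m≤n⇒m≤1+n (≤-trans (n≤1+n _) (crossed-bound ck))) (m≤n⇒m≤1+n j≤n) x≡
      ... | refl = subst (λ a → CycEdge c₂ (q b (suc m)) (q a (suc (suc m))))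
                     (¬-not λ { refl → y≢ refl }) e′
      forkUp {k} {b} {b′} ck e | m , refl | y , e′ , y≢
          | inj₂ (inj₁ (j , d , d′ , j≤n , str , refl , x≡))
            with q-level b d′ (m≤n⇒m≤1+n (≤-trans (n≤1+n _) (crossed-bound ck))) (s≤s j≤n) x≡
      ... | refl = ⊥-elim (noStraight j≤n (crossed-pred ck) d≡d′
                     (swap (subst (λ a → CycEdge c₂ a (q d m)) x≡ e′)))
        where
        d≡d′ : d ≡ d′
        d≡d′ = [ (λ r → r) , (λ cm → ⊥-elim (not-¬ refl (trans (sym cm) (crossed-pred {m} ck)))) ]′ str
      forkUp {k} {b} {b′} ck e | m , refl | y , e′ , y≢
          | inj₂ (inj₂ (inj₁ (j , d , j<n , ¬cj , _ , x≡ , _)))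
            with q-level b d (m≤n⇒m≤1+n (≤-trans (n≤1+n _) (crossed-bound ck))) (m≤n⇒m≤1+n j<n) x≡
      ... | refl = ⊥-elim (not-¬ refl (trans (sym ck) ¬cj))
      forkUp {k} {b} {b′} ck e | m , refl | y , e′ , y≢ | inj₂ (inj₂ (inj₂ ue)) = ⊥-elim (c₂-avoids-e e′ ue)

      forkDown : ∀ {k b b′} → crossed k ≡ true → CycEdge c₂ (q b k) (q b′ (suc k)) →
        CycEdge c₂ (q (not b) k) (q b′ (suc k))
      forkDown {k} {b} {b′} ck e with fork G cyc₂ (swap e)
      ... | y , e′ , y≢ with classify (CycEdge⇒E G cyc₂ e′)
      ... | inj₁ (j , d , d′ , j≤n , str , x≡ , refl)
            with q-level b′ d (s≤s (≤-trans (n≤1+n _) (crossed-bound ck))) (m≤n⇒m≤1+n j≤n) x≡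
      ... | refl = ⊥-elim (noStraight j≤n (crossed-suc {k} ck) d≡d′
                     (subst (λ a → CycEdge c₂ a (q d′ (suc (suc k)))) x≡ e′))
        where
        d≡d′ : d ≡ d′
        d≡d′ = [ (λ r → r) , (λ cm → ⊥-elim (not-¬ refl (trans (sym cm) (crossed-suc {k} ck)))) ]′ str
      forkDown {k} {b} {b′} ck e | y , e′ , y≢ | inj₂ (inj₁ (j , d , d′ , j≤n , _ , refl , x≡))
            with q-level b′ d′ (s≤s (≤-trans (n≤1+n _) (crossed-bound ck))) (s≤s j≤n) x≡
      ... | refl = subst (λ a → CycEdge c₂ (q a k) (q b′ (suc k))) (¬-not λ { refl → y≢ refl }) (swap e′)
      forkDown {k} {b} {b′} ck e | y , e′ , y≢ | inj₂ (inj₂ (inj₁ (j , d , j<n , _ , ¬cj , x≡ , _)))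
            with q-level b′ d (s≤s (≤-trans (n≤1+n _) (crossed-bound ck))) (m≤n⇒m≤1+n j<n) x≡
      ... | refl = ⊥-elim (not-¬ refl (trans (sym ck) ¬cj))
      forkDown {k} {b} {b′} ck e | y , e′ , y≢ | inj₂ (inj₂ (inj₂ ue)) = ⊥-elim (c₂-avoids-e e′ ue)

      -- `c₁` uses one edge of the 4-cycle, and `forkUp` and `forkDown` carry `c₂` from any of its
      -- edges to that one.
      noCrossed : ∀ {k b b′} → k ≤ n → crossed k ≡ true → ¬ CycEdge c₂ (q b k) (q b′ (suc k))
      noCrossed {k} {b} {b′} k≤n ck e with c₁-crosses k≤n
      ... | d , d′ , _ , e₁ with d Bool.≟ b | d′ Bool.≟ b′
      ... | yes refl | yes refl = dis _ _ e₁ e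
      ... | yes refl | no ¬p with ¬-not ¬p
      ... | refl = dis _ _ e₁ (forkUp ck e)
      noCrossed k≤n ck e | d , d′ , _ , e₁ | no ¬p | yes refl with ¬-not ¬p
      ... | refl = dis _ _ e₁ (forkDown ck e)
      noCrossed k≤n ck e | d , d′ , _ , e₁ | no ¬p | no ¬p′ with ¬-not ¬p | ¬-not ¬p′
      ... | refl | refl = dis _ _ e₁ (forkDown ck (forkUp ck e))

      noUp : ∀ {x y} → Up x y → ¬ CycEdge c₂ x y
      noUp (k , b , b′ , k≤n , str , refl , refl) with crossed k in eq | str
      ... | true  | _      = noCrossed k≤n eq
      ... | false | inj₁ p = noStraight k≤n eq p

      -- At an end of the rung `c₂` would continue along an edge between levels, already excluded,
      -- or along another rung, while each vertex has at most one.
      noRung : ∀ {x y} → Rung x y → ¬ CycEdge c₂ x y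
      noRung (k , b , k<n , _ , _ , refl , refl) e with fork G cyc₂ e
      ... | y , e′ , y≢ with classify (CycEdge⇒E G cyc₂ e′)
      ... | inj₁ up                = noUp up e′
      ... | inj₂ (inj₁ up)         = noUp up (swap e′)
      ... | inj₂ (inj₂ (inj₂ ue))  = c₂-avoids-e e′ ue
      ... | inj₂ (inj₂ (inj₁ (j , d , j<n , _ , _ , x≡ , refl)))
            with q-level b d (m≤n⇒m≤1+n k<n) (m≤n⇒m≤1+n j<n) x≡
      ... | refl with q-side b d k<n x≡
      ... | refl = y≢ refl

      contradictoryCycles : ⊥
      contradictoryCycles with firstEdge c₂ (proj₁ cyc₂)
        where
        firstEdge : ∀ c → 3 ≤ length c → ∃₂ λ x y → CycEdge {N} c x y
        firstEdge (x ∷ y ∷ _) _ = x , y , inj₁ here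
        firstEdge (x ∷ []) (s≤s ())
      ... | x , y , e with classify (CycEdge⇒E G cyc₂ e)
      ... | inj₁ up                 = noUp up e
      ... | inj₂ (inj₁ up)          = noUp up (swap e)
      ... | inj₂ (inj₂ (inj₁ rung)) = noRung rung e
      ... | inj₂ (inj₂ (inj₂ ue))   = c₂-avoids-e e ue

  -- Reading the structure as a ladder.

  structure⇒noPair : ∀ (G : Graph N) {u₁ u₂} → Structure G u₁ u₂ → ¬ HasDisjointCyclePairThrough G u₁ u₂
  structure⇒noPair G {u₁} {u₂} (n , v , w , P , (uα , _) , (uβ , _) , dis , _ , _ , valid , cov , edges)
    (c₁ , c₂ , cyc₁ , cyc₂ , disj , e∈) =
    -- The cycle that contains e takes the role of `c₁`.
    [ contradictoryCycles classify cyc₁ cyc₂ disj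
    , contradictoryCycles classify cyc₂ cyc₁ (λ x y p q → disj x y q p) ]′ e∈
    where
    p : Bool → Fin n → Fin N
    p true  = v
    p false = w
    unique : ∀ b → Unique (pathList u₁ (p b) u₂)
    unique true  = uα
    unique false = uβ
    cover : ∀ x → ∃[ b ] x ∈ pathList u₁ (p b) u₂
    cover x = [ (true ,_) , (false ,_) ]′ (cov x)
    open Ladder G u₁ u₂ p P unique dis valid cover
    q-p : ∀ b i → p b i ≡ q b (suc (toℕ i))
    q-p b i = sym (at-tabulate u₂ (p b) i)
    crossed-P : ∀ i → crossed (suc (toℕ i)) ≡ P i
    crossed-P = at-tabulate false P
    path⇒Up : ∀ b {x y} → Consec (pathList u₁ (p b) u₂) x y → Up x y
    path⇒Up b c with Consec-snoc⇒at u₂ (u₁ ∷ tabulate (p b)) c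
    ... | k , k< , x≡ , y≡ =
      k , b , b , subst (k ≤_) (length-tabulate (p b)) (≤-pred k<) , inj₁ refl , sym x≡ , sym y≡
    crossing⇒Up : ∀ b {i j} → P i ≡ true → toℕ j ≡ suc (toℕ i) → Up (p b i) (p (not b) j)
    crossing⇒Up b {i} {j} Pi j≡ = suc (toℕ i) , b , not b , toℕ<n i , inj₂ (trans (crossed-P i) Pi) , q-p b i ,
      trans (q-p (not b) j) (cong (λ k → q (not b) (suc k)) j≡)
    ¬crossed-before : ∀ k → Uncovered {N} P k → crossed (toℕ k) ≡ false
    ¬crossed-before k (_ , ¬P<k) = ¬-not contra
      where
      contra : crossed (toℕ k) ≢ true
      contra ck with crossed⁻ {toℕ k} ck
      ... | i , k≡ , Pi = not-¬ refl (trans (sym Pi) (¬P<k i k≡))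
    uncovered⇒Rung : ∀ b k → Uncovered {N} P k → Rung (p b k) (p (not b) k)
    uncovered⇒Rung b k unc = toℕ k , b , toℕ<n k , trans (crossed-P k) (proj₁ unc) , ¬crossed-before k unc ,
      q-p b k , q-p (not b) k
    classify : ∀ {x y} → E G x y ≡ true → Up x y ⊎ Up y x ⊎ Rung x y ⊎ UEdge u₁ u₂ x y
    classify {x} {y} e with proj₁ (edges x y) e
    ... | inj₁ (i , j , Pi , j≡ , inj₁ (inj₁ (refl , refl))) = inj₁ (crossing⇒Up true Pi j≡)
    ... | inj₁ (i , j , Pi , j≡ , inj₁ (inj₂ (refl , refl))) = inj₂ (inj₁ (crossing⇒Up true Pi j≡))
    -- This diagonal climbs from `w i` to `v j`, so it starts on the `false` side and its direction
    -- is reversed.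
    ... | inj₁ (i , j , Pi , j≡ , inj₂ (inj₁ (refl , refl))) = inj₂ (inj₁ (crossing⇒Up false Pi j≡))
    ... | inj₁ (i , j , Pi , j≡ , inj₂ (inj₂ (refl , refl))) = inj₁ (crossing⇒Up false Pi j≡)
    ... | inj₂ (inj₁ (k , unc , inj₁ (refl , refl))) = inj₂ (inj₂ (inj₁ (uncovered⇒Rung true k unc)))
    ... | inj₂ (inj₁ (k , unc , inj₂ (refl , refl))) = inj₂ (inj₂ (inj₁ (uncovered⇒Rung false k unc)))
    ... | inj₂ (inj₂ (inj₁ (inj₁ c))) = inj₁ (path⇒Up true c)
    ... | inj₂ (inj₂ (inj₁ (inj₂ c))) = inj₂ (inj₁ (path⇒Up true c))
    ... | inj₂ (inj₂ (inj₂ (inj₁ (inj₁ c)))) = inj₁ (path⇒Up false c)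
    ... | inj₂ (inj₂ (inj₂ (inj₁ (inj₂ c)))) = inj₂ (inj₁ (path⇒Up false c))
    ... | inj₂ (inj₂ (inj₂ (inj₂ u))) = inj₂ (inj₂ (inj₂ u))

theorem1p4 : (N : ℕ) (G : Graph N) → ThreeConnected G →
    (u1 u2 : Fin N) → E G u1 u2 ≡ true →
    (¬ HasDisjointCyclePairThrough G u1 u2) ⇔ Structure G u1 u2
theorem1p4 N G 3conn u1 u2 e = mk⇔ (Detour.noPair⇒structure G 3conn u1 u2 e) (structure⇒noPair G)
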